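{- For every tournament $T$ on $n$ vertices, $$c(T,5) \le \frac{3}{4}\binom{n}{5} + \frac{1}{4}\binom{n}{2}\left(\frac{n-2}{2}\right)^2,$$ where $c(T,5)$ is the number of directed 5-cycles in $T$.
   Context: A tournament on $n$ vertices (an $n$-tournament) is a directed graph $T=(V,E)$ with $|V|=n$, without loops, such that for every pair of distinct vertices $u,v$ exactly one of $(u,v),(v,u)$ lies in $E$. The quantity $c(T,k)$ is the number of directed $k$-cycles of $T$, counted as subgraphs (i.e. cyclic rotations of the same vertex sequence give the same cycle). -}

module Defs where

open import Data.Fin.Base using (Fin; toℕ)
import Data.Fin.Properties as Fin
open import Data.List.Base using (List; []; _∷_; allFin; cartesianProductWith; deduplicate; filter; length)
open import Data.Nat.Base using (ℕ; zero; suc; _+_; NonZero)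
open import Data.Nat.DivMod using (_mod_)
open import Data.Product.Base using (_×_; _,_; ∃-syntax)
open import Data.Rational.Base using (ℚ; _*_)
open import Data.Sum.Base using (_⊎_; inj₁; inj₂)
open import Data.Vec.Base using (Vec; []; _∷_; lookup)
open import Level using (0ℓ)
open import Relation.Binary.Core using (Rel)
open import Relation.Binary.Definitions using (Decidable)
open import Relation.Binary.PropositionalEquality using (_≡_; _≢_; refl)
open import Relation.Nullary using (¬_; Dec; yes; no)
open import Relation.Nullary.Decidable using (_×-dec_; _→-dec_)

record Tournament (n : ℕ) : Set₁ where
  infix 4 _⟶_ _⟶?_
  field
    _⟶_      : Rel (Fin n) 0ℓ
    loopless : ∀ u → ¬ (u ⟶ u)
    oneOf    : ∀ {u v} → u ≢ v →
               ((u ⟶ v) × ¬ (v ⟶ u)) ⊎ (¬ (u ⟶ v) × (v ⟶ u))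

  _⟶?_ : Decidable _⟶_
  u ⟶? v with u Fin.≟ v
  ... | yes refl = no (loopless u)
  ... | no u≢v with oneOf u≢v
  ...   | inj₁ (u⟶v , _) = yes u⟶v
  ...   | inj₂ (¬u⟶v , _) = no ¬u⟶v

allVecs : (n k : ℕ) → List (Vec (Fin n) k)
allVecs n zero    = [] ∷ []
allVecs n (suc k) = cartesianProductWith _∷_ (allFin n) (allVecs n k)

module _ {k : ℕ} .{{_ : NonZero k}} where

  -- v 0 → v 1 → ⋯ → v (k - 1) → v 0 with pairwise distinct entries.
  IsCycle : ∀ {n} → Tournament n → Vec (Fin n) k → Set
  IsCycle T v =
    (∀ i j → lookup v i ≡ lookup v j → i ≡ j) ×
    (∀ i → lookup v i ⟶ lookup v (suc (toℕ i) mod k))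
    where open Tournament T

  isCycle? : ∀ {n} (T : Tournament n) (v : Vec (Fin n) k) → Dec (IsCycle T v)
  isCycle? T v =
    Fin.all? (λ i → Fin.all? λ j →
      (lookup v i Fin.≟ lookup v j) →-dec (i Fin.≟ j))
    ×-dec
    Fin.all? (λ i → lookup v i ⟶? lookup v (suc (toℕ i) mod k))
    where open Tournament T

  infix 4 _≈ᵣ_ _≈ᵣ?_

  _≈ᵣ_ : ∀ {n} → Rel (Vec (Fin n) k) 0ℓ
  v ≈ᵣ w = ∃[ r ] ∀ (i : Fin k) →
    lookup w i ≡ lookup v ((toℕ i + toℕ {k} r) mod k)

  _≈ᵣ?_ : ∀ {n} → Decidable (_≈ᵣ_ {n})
  v ≈ᵣ? w = Fin.any? λ r → Fin.all? λ i →
    lookup w i Fin.≟ lookup v ((toℕ i + toℕ r) mod k)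

-- A directed k-cycle as a subgraph is a rotation class of cyclic vertex
-- sequences; deduplicate keeps one sequence from each class.
c : ∀ {n} → Tournament n → (k : ℕ) → .{{_ : NonZero k}} → ℕ
c {n} T k = length (deduplicate _≈ᵣ?_ (filter (isCycle? T) (allVecs n k)))

infix 8 _²

_² : ℚ → ℚ
q ² = q * q

{-# OPTIONS --safe #-}
-- Let A be the ±1 adjacency matrix of T.  A cyclic sequence contributes 32 to
-- the sum of ∏ (1 + A) over the cyclic edges of all 5-tuples of distinct
-- vertices.  Reversal kills the monomials of odd degree and a transposition
-- kills A₁₂ A₃₄, so only the constant, the paths A₁₂ A₂₃ and the paths
-- A₁₂ A₂₃ A₃₄ A₄₅ survive.  Fix the second and fourth vertices j ≠ l, put
-- N = n - 2, and let α, β, δ be the sums of a, b, a b over the other vertices,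
-- where a = A j · and b = A l ·.  Everything becomes a sum over (j , l) of
--   N (N - 1) (N - 2) + 5 (N² + α β δ - N (α² + β²) / 2 - δ²),
-- and |δ| ≤ N gives α β δ ≤ N (α² + β²) / 2.
module Submission where

open import Defs
open import Data.Fin.Base using (Fin; toℕ)
import Data.Fin.Properties as Fin
open import Data.Integer.Base as ℤ using (+_)
open import Data.List.Base as List using (List; []; _∷_; _++_; length; filter; map; cartesianProductWith)
import Data.List.Properties as List
open import Data.Nat.Base using (ℕ)
open import Data.Nat.Combinatorics using (_C_)
open import Data.Nat.DivMod using (_mod_)
open import Data.Product.Base using (_,_)
open import Data.Sum.Base using (inj₁; inj₂)
open import Data.Vec.Base using (Vec; []; _∷_; lookup)
open import Function.Base using (_∘_)
open import Relation.Binary.PropositionalEquality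
open import Relation.Nullary using (contradiction)

-- Each edge of a path on five vertices meets exactly one of the second and fourth vertices. Once
-- these are fixed, every other vertex enters only through 1, a, b or a b, so a path sum is a
-- product of one-variable sums up to corrections for coinciding vertices. To let the sums run over
-- all of `Fin n`, both rows are multiplied by the indicator `w` of the vertices other than j and l.
-- The masked rows `p` and `q` satisfy p² = q² = w, so the corrections are again polynomials in N,
-- α, β, δ. Apart from those turning N³ into N (N - 1) (N - 2), they add up to 5 (N² - δ²). All
-- counting stays in ℤ. This is why sums appear doubled: 2 + 5 · paths accounts, after
-- symmetrisation, for a sequence together with its reversal. One-sided counts suffice: a cycle has
-- at least five sequences, and a tuple that is not a cycle contributes nonnegatively.

module Rotations where

  open import Data.Nat.Base using (zero; suc; _+_; _*_; _∸_; _≤_; z≤n; s≤s; NonZero)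
  open import Data.Nat.DivMod using (_%_; m%n%n≡m%n; %-distribˡ-+; m<n⇒m%n≡m; [m+n]%n≡m%n)
  import Data.Nat.Properties as ℕ
  open import Data.List.Base using (concat; deduplicate)
  open import Data.List.Membership.Propositional using (_∈_)
  open import Data.List.Membership.Propositional.Properties
    using (∈-filter⁺; ∈-∃++; ∈-++⁺ˡ; ∈-++⁺ʳ; ∈-++⁻; ∈-cartesianProductWith⁺; ∈-allFin; ∈-concat⁻′; ∈-map⁻; ∈-tabulate⁻)
  open import Data.List.Relation.Binary.Disjoint.Propositional using (Disjoint)
  open import Data.List.Relation.Binary.Subset.Propositional using (_⊆_)
  open import Data.List.Relation.Unary.Any using (here; there)
  open import Data.List.Relation.Unary.All as All using (All; []; _∷_)
  import Data.List.Relation.Unary.All.Properties as All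
  open import Data.List.Relation.Unary.AllPairs as AllPairs using (AllPairs; []; _∷_)
  import Data.List.Relation.Unary.AllPairs.Properties as AllPairs
  open import Data.List.Relation.Unary.Unique.Propositional using (Unique)
  import Data.List.Relation.Unary.Unique.Propositional.Properties as Unique
  open import Data.Vec.Base using (tabulate)
  open import Data.Vec.Properties using (lookup∘tabulate)
  open import Level using (Level)
  open import Relation.Binary.Core using (Rel)
  import Relation.Binary.Definitions as B
  open import Relation.Nullary using (¬_)
  open import Relation.Nullary.Decidable using (¬?)

  -- Lists without repetition.

  private variable
    a ℓ : Level
    X Y : Set a

  -- Pigeonhole principle: deleting one occurrence of `x` from `ys` preserves the inclusion of the
  -- tail, because `x` does not recur there.
  Unique-⊆⇒length-≤ : {xs ys : List X} → Unique xs → xs ⊆ ys → length xs ≤ length ys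
  Unique-⊆⇒length-≤ [] _ = z≤n
  Unique-⊆⇒length-≤ {xs = x ∷ xs} (x∉xs ∷ xs!) sub with ∈-∃++ (sub (here refl))
  ... | ps , qs , refl = begin
    suc (length xs)           ≤⟨ s≤s (Unique-⊆⇒length-≤ xs! sub′) ⟩
    suc (length (ps ++ qs))   ≡⟨ cong suc (List.length-++ ps) ⟩
    suc (length ps + length qs) ≡⟨ ℕ.+-suc _ _ ⟨
    length ps + suc (length qs) ≡⟨ List.length-++ ps ⟨
    length (ps ++ x ∷ qs)     ∎
    where
    open ℕ.≤-Reasoning
    sub′ : xs ⊆ ps ++ qs
    sub′ z∈xs with ∈-++⁻ ps (sub (there z∈xs))
    ... | inj₁ z∈ps         = ∈-++⁺ˡ z∈ps
    ... | inj₂ (here refl)  = contradiction refl (All.lookup x∉xs z∈xs)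
    ... | inj₂ (there z∈qs) = ∈-++⁺ʳ ps z∈qs

  -- `deduplicate` keeps the head and filters the already deduplicated tail by the negation of
  -- `R x`, so each earlier entry is unrelated to each later one, in this order.
  deduplicate-AllPairs : {R : Rel X ℓ} (R? : B.Decidable R) → ∀ xs →
                         AllPairs (λ x y → ¬ R x y) (deduplicate R? xs)
  deduplicate-AllPairs R? []       = []
  deduplicate-AllPairs R? (x ∷ xs) =
    All.all-filter (¬? ∘ R? x) (deduplicate R? xs) ∷ AllPairs.filter⁺ (¬? ∘ R? x) (deduplicate-AllPairs R? xs)

  length-concat-tabulate : ∀ {k} (f : X → Fin k → Y) xs →
    length (concat (List.map (List.tabulate ∘ f) xs)) ≡ length xs * k
  length-concat-tabulate f []       = refl
  length-concat-tabulate f (x ∷ xs) =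
    trans (List.length-++ (List.tabulate (f x)))
      (cong₂ _+_ (List.length-tabulate (f x)) (length-concat-tabulate f xs))

  ∈-allVecs : ∀ {n k} (v : Vec (Fin n) k) → v ∈ allVecs n k
  ∈-allVecs []      = here refl
  ∈-allVecs (x ∷ v) = ∈-cartesianProductWith⁺ _∷_ (∈-allFin x) (∈-allVecs v)

  -- Addition modulo `k` and rotation of sequences.

  module _ {k : ℕ} .{{_ : NonZero k}} where

    infixl 6 _⊕_
    infix 8 ⊖_

    _⊕_ : Fin k → Fin k → Fin k
    i ⊕ j = (toℕ i + toℕ j) mod k

    -- At zero the difference is `k`, which the final `mod` folds back to zero.
    ⊖_ : Fin k → Fin k
    ⊖ i = (k ∸ toℕ i) mod k

    toℕ-mod : ∀ m → toℕ (m mod k) ≡ m % k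
    toℕ-mod m = Fin.toℕ-fromℕ< _

    mod-cong : ∀ {m n} → m % k ≡ n % k → m mod k ≡ n mod k
    mod-cong {m} {n} eq = Fin.toℕ-injective (trans (toℕ-mod m) (trans eq (sym (toℕ-mod n))))

    mod-toℕ : ∀ i → toℕ i mod k ≡ i
    mod-toℕ i = Fin.toℕ-injective (trans (toℕ-mod _) (m<n⇒m%n≡m (Fin.toℕ<n i)))

    mod-+ˡ : ∀ m n → (toℕ (m mod k) + n) mod k ≡ (m + n) mod k
    mod-+ˡ m n = mod-cong (begin
      (toℕ (m mod k) + n) % k   ≡⟨ cong (λ x → (x + n) % k) (toℕ-mod m) ⟩
      (m % k + n) % k           ≡⟨ %-distribˡ-+ (m % k) n k ⟩
      (m % k % k + n % k) % k   ≡⟨ cong (λ x → (x + n % k) % k) (m%n%n≡m%n m k) ⟩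
      (m % k + n % k) % k       ≡⟨ %-distribˡ-+ m n k ⟨
      (m + n) % k               ∎)
      where open ≡-Reasoning

    ⊕-comm : ∀ i j → i ⊕ j ≡ j ⊕ i
    ⊕-comm i j = cong (_mod k) (ℕ.+-comm (toℕ i) (toℕ j))

    ⊕-assoc : ∀ i j l → (i ⊕ j) ⊕ l ≡ i ⊕ (j ⊕ l)
    ⊕-assoc i j l = begin
      (i ⊕ j) ⊕ l                        ≡⟨ mod-+ˡ _ _ ⟩
      (toℕ i + toℕ j + toℕ l) mod k      ≡⟨ cong (_mod k) (ℕ.+-assoc (toℕ i) _ _) ⟩
      -- `mod-+ˡ` absorbs a reduction in the left summand only, so `j ⊕ l` has to be brought to the
      -- left.
      (toℕ i + (toℕ j + toℕ l)) mod k    ≡⟨ cong (_mod k) (ℕ.+-comm (toℕ i) _) ⟩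
      (toℕ j + toℕ l + toℕ i) mod k      ≡⟨ mod-+ˡ _ _ ⟨
      (j ⊕ l) ⊕ i                        ≡⟨ ⊕-comm (j ⊕ l) i ⟩
      i ⊕ (j ⊕ l)                        ∎
      where open ≡-Reasoning

    ⊕-cancelʳ : ∀ i j → (i ⊕ ⊖ j) ⊕ j ≡ i
    ⊕-cancelʳ i j = begin
      (i ⊕ ⊖ j) ⊕ j                         ≡⟨ ⊕-assoc i (⊖ j) j ⟩
      i ⊕ (⊖ j ⊕ j)                         ≡⟨ cong (i ⊕_) (mod-+ˡ _ _) ⟩
      i ⊕ ((k ∸ toℕ j + toℕ j) mod k)       ≡⟨ cong (λ x → i ⊕ (x mod k)) (ℕ.m∸n+n≡m (ℕ.<⇒≤ (Fin.toℕ<n j))) ⟩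
      i ⊕ (k mod k)                         ≡⟨ ⊕-comm i _ ⟩
      (k mod k) ⊕ i                         ≡⟨ mod-+ˡ _ _ ⟩
      (k + toℕ i) mod k                     ≡⟨ cong (_mod k) (ℕ.+-comm k _) ⟩
      (toℕ i + k) mod k                     ≡⟨ mod-cong ([m+n]%n≡m%n (toℕ i) k) ⟩
      toℕ i mod k                           ≡⟨ mod-toℕ i ⟩
      i                                     ∎
      where open ≡-Reasoning

    ⊕-injective : ∀ l {i j} → i ⊕ l ≡ j ⊕ l → i ≡ j
    ⊕-injective l {i} {j} eq =
      trans (sym (undo i)) (trans (cong (_⊕ ⊖ l) eq) (undo j))
      where
      undo : ∀ i → (i ⊕ l) ⊕ ⊖ l ≡ i
      undo i = trans (⊕-assoc i l (⊖ l)) (trans (cong (i ⊕_) (⊕-comm l (⊖ l)))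
                 (trans (sym (⊕-assoc i (⊖ l) l)) (⊕-cancelʳ i l)))

    rotate : Vec X k → Fin k → Vec X k
    rotate v r = tabulate λ i → lookup v (i ⊕ r)

    lookup-rotate : ∀ (v : Vec X k) r i → lookup (rotate v r) i ≡ lookup v (i ⊕ r)
    lookup-rotate v r = lookup∘tabulate _

    -- Undoing the shift `s` exhibits `w` as `v` rotated by `⊖ s ⊕ r`. The relation comes out in the
    -- order `v`, `w`, the one that `deduplicate` has excluded.
    rotate-≡⇒≈ᵣ : ∀ {n} (v w : Vec (Fin n) k) r s → rotate v r ≡ rotate w s → v ≈ᵣ w
    rotate-≡⇒≈ᵣ v w r s eq = ⊖ s ⊕ r , λ i → begin
      lookup w i                       ≡⟨ cong (lookup w) (⊕-cancelʳ i s) ⟨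
      lookup w ((i ⊕ ⊖ s) ⊕ s)         ≡⟨ lookup-rotate w s _ ⟨
      lookup (rotate w s) (i ⊕ ⊖ s)    ≡⟨ cong (λ u → lookup u (i ⊕ ⊖ s)) eq ⟨
      lookup (rotate v r) (i ⊕ ⊖ s)    ≡⟨ lookup-rotate v r _ ⟩
      lookup v ((i ⊕ ⊖ s) ⊕ r)         ≡⟨ cong (lookup v) (⊕-assoc i (⊖ s) r) ⟩
      lookup v (i ⊕ (⊖ s ⊕ r))         ∎
      where open ≡-Reasoning

    -- Rotation orbits of directed cycles.

    module _ {n} (T : Tournament n) where
      open Tournament T

      rotate-IsCycle : ∀ v → IsCycle T v → ∀ r → IsCycle T (rotate v r)
      rotate-IsCycle v (distinct , edges) r =
        (λ i j eq → ⊕-injective r (distinct _ _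
          (trans (sym (lookup-rotate v r i)) (trans eq (lookup-rotate v r j))))) ,
        (λ i → subst₂ _⟶_ (sym (lookup-rotate v r i))
          (trans (cong (lookup v) (next i)) (sym (lookup-rotate v r _))) (edges (i ⊕ r)))
        where
        next : ∀ i → suc (toℕ (i ⊕ r)) mod k ≡ (suc (toℕ i) mod k) ⊕ r
        next i = begin
          suc (toℕ (i ⊕ r)) mod k       ≡⟨ cong (_mod k) (ℕ.+-comm 1 (toℕ (i ⊕ r))) ⟩
          (toℕ (i ⊕ r) + 1) mod k       ≡⟨ mod-+ˡ _ 1 ⟩
          (toℕ i + toℕ r + 1) mod k     ≡⟨ cong (_mod k) (ℕ.+-comm _ 1) ⟩
          (suc (toℕ i) + toℕ r) mod k   ≡⟨ mod-+ˡ _ _ ⟨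
          (suc (toℕ i) mod k) ⊕ r       ∎
          where open ≡-Reasoning

      rotate-injective : ∀ v → IsCycle T v → ∀ {r s} → rotate v r ≡ rotate v s → r ≡ s
      rotate-injective v (distinct , _) {r} {s} eq = ⊕-injective r
        -- Position `r` of the two rotations reads `v` at `r ⊕ r` and at `r ⊕ s`; distinctness of
        -- the vertices identifies these positions.
        (trans (distinct _ _ (begin
          lookup v (r ⊕ r)         ≡⟨ lookup-rotate v r r ⟨
          lookup (rotate v r) r    ≡⟨ cong (λ u → lookup u r) eq ⟩
          lookup (rotate v s) r    ≡⟨ lookup-rotate v s r ⟩
          lookup v (r ⊕ s)         ∎)) (⊕-comm r s))
        where open ≡-Reasoning

      -- A representative has `k` different rotations, all of them cycles, and different
      -- representatives have disjoint orbits. The concatenated orbits are therefore a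
      -- repetition-free list of cyclic sequences, with `k` entries per representative.
      c*k≤cyclic : c T k * k ≤ length (filter (isCycle? T) (allVecs n k))
      c*k≤cyclic = begin
        length reps * k              ≡⟨ length-concat-tabulate rotate reps ⟨
        length (concat orbits)       ≤⟨ Unique-⊆⇒length-≤ (Unique.concat⁺ orbits! disjoint) orbits⊆ ⟩
        length (filter (isCycle? T) (allVecs n k)) ∎
        where
        open ℕ.≤-Reasoning
        reps = deduplicate _≈ᵣ?_ (filter (isCycle? T) (allVecs n k))
        orbits = List.map (List.tabulate ∘ rotate) reps

        cyclic : All (IsCycle T) reps
        cyclic = All.deduplicate⁺ _≈ᵣ?_ (All.all-filter (isCycle? T) (allVecs n k))

        orbits! : All Unique orbits
        orbits! = All.map⁺ (All.map (λ {v} cyc → Unique.tabulate⁺ (rotate-injective v cyc)) cyclic)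

        orbits-disjoint : ∀ v w → ¬ v ≈ᵣ w →
          Disjoint (List.tabulate (rotate v)) (List.tabulate (rotate w))
        orbits-disjoint v w v≉w (u∈v , u∈w) with ∈-tabulate⁻ u∈v | ∈-tabulate⁻ u∈w
        ... | r , u≡v | s , u≡w = v≉w (rotate-≡⇒≈ᵣ v w r s (trans (sym u≡v) u≡w))

        disjoint : AllPairs Disjoint orbits
        disjoint = AllPairs.map⁺ (AllPairs.map (λ {v} {w} → orbits-disjoint v w)
          (deduplicate-AllPairs _≈ᵣ?_ (filter (isCycle? T) (allVecs n k))))

        orbits⊆ : concat orbits ⊆ filter (isCycle? T) (allVecs n k)
        orbits⊆ u∈ with ∈-concat⁻′ orbits u∈
        ... | _ , u∈o , o∈ with ∈-map⁻ (List.tabulate ∘ rotate) o∈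
        ... | v , v∈ , refl with ∈-tabulate⁻ u∈o
        ... | r , refl = ∈-filter⁺ (isCycle? T) (∈-allVecs _) (rotate-IsCycle v (All.lookup cyclic v∈) r)

-- Integer indicators of equality.

module SignSums where

  open Rotations using (c*k≤cyclic)
  open import Data.Bool.Base using (if_then_else_)
  open import Data.Fin.Base using (zero; suc)
  open import Data.Fin.Patterns using (0F; 1F; 2F; 3F; 4F)
  open import Data.Integer.Base using (ℤ; -[1+_]; +≤+; -1ℤ; 0ℤ; 1ℤ; _+_; _-_; -_; _*_; _≤_)
  import Data.Integer.Properties as ℤ
  open import Data.Integer.Tactic.RingSolver
  open import Data.Nat.Base as ℕ using (zero; suc; _!)
  open import Data.Nat.Combinatorics using (nCk+nC[k+1]≡[n+1]C[k+1])
  import Data.Rational.Base as ℚ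
  import Data.Rational.Properties as ℚ
  import Data.Rational.Unnormalised.Base as ℚᵘ
  import Data.Rational.Unnormalised.Properties as ℚᵘ
  import Algebra.Properties.Semiring.Sum ℤ.+-*-semiring as Sum
  open import Level using (0ℓ)
  open import Relation.Nullary using (Dec; yes; no; does)
  open import Relation.Nullary.Decidable using (dec-true; dec-false)
  open import Relation.Unary using (Pred; Decidable)

  private variable
    n : ℕ
    P : Set

  ⟦_⟧ : Dec P → ℤ
  ⟦ p? ⟧ = if does p? then 1ℤ else 0ℤ

  eq ne : Fin n → Fin n → ℤ
  eq i j = ⟦ i Fin.≟ j ⟧
  ne i j = 1ℤ - eq i j

  eq-refl : (i : Fin n) → eq i i ≡ 1ℤ
  eq-refl i rewrite dec-true (i Fin.≟ i) refl = refl

  eq-≢ : {i j : Fin n} → i ≢ j → eq i j ≡ 0ℤ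
  eq-≢ {i = i} {j} i≢j rewrite dec-false (i Fin.≟ j) i≢j = refl

  ne-refl : (i : Fin n) → ne i i ≡ 0ℤ
  ne-refl i rewrite eq-refl i = refl

  ne-≢ : {i j : Fin n} → i ≢ j → ne i j ≡ 1ℤ
  ne-≢ i≢j rewrite eq-≢ i≢j = refl

  ne-sym : (i j : Fin n) → ne i j ≡ ne j i
  ne-sym i j with i Fin.≟ j
  ... | yes refl rewrite eq-refl i = refl
  ... | no i≢j = sym (ne-≢ (i≢j ∘ sym))

  ne-nonneg : (i j : Fin n) → 0ℤ ≤ ne i j
  ne-nonneg i j with i Fin.≟ j
  ... | yes _ = ℤ.≤-refl
  ... | no _  = +≤+ ℕ.z≤n

  ne-idem : (i j : Fin n) → ne i j * ne i j ≡ ne i j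
  ne-idem i j with i Fin.≟ j
  ... | yes _ = refl
  ... | no _  = refl

  -- If `i ≢ k`, then `m` equals at most one of them and the cross term `eq i m * eq k m` vanishes.
  -- What remains is linear in the indicators, so a sum over `m` collapses.
  ne-distinct : (i k m : Fin n) → ne i k * ne i m * ne k m ≡ ne i k * (1ℤ - eq i m - eq k m)
  ne-distinct i k m with i Fin.≟ k
  ... | yes _ = refl
  ... | no i≢k with i Fin.≟ m | k Fin.≟ m
  ...   | yes refl | yes refl = contradiction refl i≢k
  ...   | yes _    | no _     = refl
  ...   | no _     | yes _    = refl
  ...   | no _     | no _     = refl

  -- Finite sums of integers.

  -- Opaque, so that the summand can be inferred by unification.
  opaque
    ∑ : (Fin n → ℤ) → ℤ
    ∑ = Sum.sum

    ∑-zero : (f : Fin 0 → ℤ) → ∑ f ≡ 0ℤ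
    ∑-zero f = refl

    ∑-suc : (f : Fin (suc n) → ℤ) → ∑ f ≡ f zero + ∑ (λ i → f (suc i))
    ∑-suc f = refl

    ∑-cong : {f g : Fin n → ℤ} → (∀ i → f i ≡ g i) → ∑ f ≡ ∑ g
    ∑-cong = Sum.sum-cong-≗

    ∑-comm : (f : Fin n → Fin n → ℤ) → ∑ (λ i → ∑ (f i)) ≡ ∑ (λ j → ∑ λ i → f i j)
    ∑-comm = Sum.∑-comm

    ∑-+ : (f g : Fin n → ℤ) → ∑ (λ i → f i + g i) ≡ ∑ f + ∑ g
    ∑-+ = Sum.∑-distrib-+

    ∑-*ˡ : ∀ x (f : Fin n → ℤ) → ∑ (λ i → x * f i) ≡ x * ∑ f
    ∑-*ˡ x f = sym (Sum.*-distribˡ-sum x f)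

  ∑-neg : (f : Fin n → ℤ) → ∑ (λ i → - f i) ≡ - ∑ f
  ∑-neg f = trans (∑-cong (λ i → sym (ℤ.-1*i≡-i (f i)))) (trans (∑-*ˡ -1ℤ f) (ℤ.-1*i≡-i (∑ f)))

  ∑-- : (f g : Fin n → ℤ) → ∑ (λ i → f i - g i) ≡ ∑ f - ∑ g
  ∑-- f g = trans (∑-+ f (λ i → - g i)) (cong (λ x → ∑ f + x) (∑-neg g))

  ∑-mono-≤ : {f g : Fin n → ℤ} → (∀ i → f i ≤ g i) → ∑ f ≤ ∑ g
  ∑-mono-≤ {n = zero}  {f} {g} _ = subst₂ _≤_ (sym (∑-zero f)) (sym (∑-zero g)) ℤ.≤-refl
  ∑-mono-≤ {n = suc _} {f} {g} f≤g = subst₂ _≤_ (sym (∑-suc f)) (sym (∑-suc g))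
    (ℤ.+-mono-≤ (f≤g zero) (∑-mono-≤ (λ i → f≤g (suc i))))

  ∑-const : ∀ n x → ∑ {n} (λ _ → x) ≡ + n * x
  ∑-const zero    x = trans (∑-zero (λ _ → x)) (sym (ℤ.*-zeroˡ x))
  ∑-const (suc n) x = trans (∑-suc (λ _ → x)) (trans (cong (λ y → x + y) (∑-const n x)) (lemma x (+ n)))
    where
    lemma : ∀ x m → x + m * x ≡ (1ℤ + m) * x
    lemma = solve-∀

  ∑-eq : ∀ (i : Fin n) f → ∑ (λ j → eq i j * f j) ≡ f i
  ∑-eq {n = suc n} zero f = begin
    ∑ (λ j → eq zero j * f j)               ≡⟨ ∑-suc (λ j → eq zero j * f j) ⟩
    1ℤ * f zero + ∑ (λ j → 0ℤ * f (suc j))  ≡⟨ cong (λ x → 1ℤ * f zero + x) (∑-*ˡ 0ℤ (λ j → f (suc j))) ⟩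
    1ℤ * f zero + 0ℤ * ∑ (λ j → f (suc j))  ≡⟨ lemma (f zero) (∑ (λ j → f (suc j))) ⟩
    f zero                                  ∎
    where
    open ≡-Reasoning
    lemma : ∀ x y → 1ℤ * x + 0ℤ * y ≡ x
    lemma = solve-∀
  ∑-eq (suc i) f = trans (∑-suc (λ j → eq (suc i) j * f j))
    (trans (ℤ.+-identityˡ _) (∑-eq i (λ j → f (suc j))))

  ∑-ne : ∀ (i : Fin n) f → ∑ (λ j → ne i j * f j) ≡ ∑ f - f i
  ∑-ne i f = begin
    ∑ (λ j → ne i j * f j)           ≡⟨ ∑-cong (λ j → lemma (eq i j) (f j)) ⟩
    ∑ (λ j → f j - eq i j * f j)     ≡⟨ ∑-- f (λ j → eq i j * f j) ⟩
    ∑ f - ∑ (λ j → eq i j * f j)     ≡⟨ cong (λ x → ∑ f - x) (∑-eq i f) ⟩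
    ∑ f - f i                        ∎
    where
    open ≡-Reasoning
    lemma : ∀ x y → (1ℤ - x) * y ≡ y - x * y
    lemma = solve-∀

  ∑-ne² : ∀ (i k : Fin n) f →
    ∑ (λ m → ne i k * ne i m * ne k m * f m) ≡ ne i k * (∑ f - f i - f k)
  ∑-ne² i k f = begin
    ∑ (λ m → ne i k * ne i m * ne k m * f m)
      ≡⟨ ∑-cong (λ m → trans (cong (_* f m) (ne-distinct i k m)) (lemma (ne i k) (eq i m) (eq k m) (f m))) ⟩
    ∑ (λ m → ne i k * (f m - eq i m * f m - eq k m * f m))
      ≡⟨ ∑-*ˡ (ne i k) (λ m → f m - eq i m * f m - eq k m * f m) ⟩
    ne i k * ∑ (λ m → f m - eq i m * f m - eq k m * f m)
      ≡⟨ cong (λ x → ne i k * x) (trans (∑-- (λ m → f m - eq i m * f m) (λ m → eq k m * f m))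
           (cong (λ x → x - ∑ (λ m → eq k m * f m)) (∑-- f (λ m → eq i m * f m)))) ⟩
    ne i k * (∑ f - ∑ (λ m → eq i m * f m) - ∑ (λ m → eq k m * f m))
      ≡⟨ cong₂ (λ x y → ne i k * (∑ f - x - y)) (∑-eq i f) (∑-eq k f) ⟩
    ne i k * (∑ f - f i - f k) ∎
    where
    open ≡-Reasoning
    lemma : ∀ x y z t → x * (1ℤ - y - z) * t ≡ x * (t - y * t - z * t)
    lemma = solve-∀

  -- Sums over triples of distinct indices.

  Δ : Fin n → Fin n → Fin n → ℤ
  Δ i k m = ne i k * ne i m * ne k m

  -- Inclusion-exclusion: one term is subtracted for each pair of equal indices. The total
  -- coincidence, present once, is thereby subtracted three times, and the coefficient 2 corrects
  -- this.
  distinct-triples : ∀ (u v w : Fin n → ℤ) →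
    ∑ (λ i → ∑ λ k → ∑ λ m → Δ i k m * (u i * v k * w m)) ≡
    ∑ u * ∑ v * ∑ w - ∑ (λ i → u i * v i) * ∑ w - ∑ (λ i → u i * w i) * ∑ v
      - ∑ u * ∑ (λ i → v i * w i) + + 2 * ∑ (λ i → u i * v i * w i)
  distinct-triples u v w = begin
    ∑ (λ i → ∑ λ k → ∑ λ m → Δ i k m * (u i * v k * w m))
      ≡⟨ ∑-cong (λ i → ∑-cong (inner i)) ⟩
    ∑ (λ i → ∑ λ k → ne i k * (u i * (v k * (∑ w - w i) - v k * w k)))
      ≡⟨ ∑-cong middle ⟩
    ∑ (λ i → ∑ v * ∑ w * u i - ∑ v * (u i * w i) - VW * u i - ∑ w * (u i * v i) + + 2 * (u i * v i * w i))
      ≡⟨ trans (∑-+ (λ i → ∑ v * ∑ w * u i - ∑ v * (u i * w i) - VW * u i - ∑ w * (u i * v i))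
                    (λ i → + 2 * (u i * v i * w i)))
           (cong₂ _+_ (trans (∑-- (λ i → ∑ v * ∑ w * u i - ∑ v * (u i * w i) - VW * u i) (λ i → ∑ w * (u i * v i)))
             (cong₂ _-_ (trans (∑-- (λ i → ∑ v * ∑ w * u i - ∑ v * (u i * w i)) (λ i → VW * u i))
               (cong₂ _-_ (trans (∑-- (λ i → ∑ v * ∑ w * u i) (λ i → ∑ v * (u i * w i)))
                 (cong₂ _-_ (∑-*ˡ (∑ v * ∑ w) u) (∑-*ˡ (∑ v) (λ i → u i * w i))))
                 (∑-*ˡ VW u)))
               (∑-*ˡ (∑ w) (λ i → u i * v i))))
             (∑-*ˡ (+ 2) (λ i → u i * v i * w i))) ⟩
    ∑ v * ∑ w * ∑ u - ∑ v * ∑ (λ i → u i * w i) - VW * ∑ u - ∑ w * ∑ (λ i → u i * v i)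
      + + 2 * ∑ (λ i → u i * v i * w i)
      ≡⟨ shuffle (∑ v) (∑ w) (∑ u) (∑ (λ i → u i * w i)) VW (∑ (λ i → u i * v i)) (∑ (λ i → u i * v i * w i)) ⟩
    ∑ u * ∑ v * ∑ w - ∑ (λ i → u i * v i) * ∑ w - ∑ (λ i → u i * w i) * ∑ v
      - ∑ u * VW + + 2 * ∑ (λ i → u i * v i * w i) ∎
    where
    open ≡-Reasoning
    VW = ∑ (λ i → v i * w i)

    shuffle : ∀ V W U UW VW UV UVW →
      V * W * U - V * UW - VW * U - W * UV + + 2 * UVW ≡ U * V * W - UV * W - UW * V - U * VW + + 2 * UVW
    shuffle = solve-∀

    inner : ∀ i k → ∑ (λ m → Δ i k m * (u i * v k * w m)) ≡ ne i k * (u i * (v k * (∑ w - w i) - v k * w k))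
    inner i k = begin
      ∑ (λ m → Δ i k m * (u i * v k * w m))   ≡⟨ ∑-cong (λ m → lemma (Δ i k m) (u i * v k) (w m)) ⟩
      ∑ (λ m → u i * v k * (Δ i k m * w m))   ≡⟨ ∑-*ˡ (u i * v k) (λ m → Δ i k m * w m) ⟩
      u i * v k * ∑ (λ m → Δ i k m * w m)     ≡⟨ cong (λ x → u i * v k * x) (∑-ne² i k w) ⟩
      u i * v k * (ne i k * (∑ w - w i - w k)) ≡⟨ lemma′ (u i) (v k) (ne i k) (∑ w) (w i) (w k) ⟩
      ne i k * (u i * (v k * (∑ w - w i) - v k * w k)) ∎
      where
      lemma : ∀ x y z → x * (y * z) ≡ y * (x * z)
      lemma = solve-∀
      lemma′ : ∀ u v e W a b → u * v * (e * (W - a - b)) ≡ e * (u * (v * (W - a) - v * b))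
      lemma′ = solve-∀

    middle : ∀ i → ∑ (λ k → ne i k * (u i * (v k * (∑ w - w i) - v k * w k))) ≡
      ∑ v * ∑ w * u i - ∑ v * (u i * w i) - VW * u i - ∑ w * (u i * v i) + + 2 * (u i * v i * w i)
    middle i = begin
      ∑ (λ k → ne i k * (u i * (v k * (∑ w - w i) - v k * w k)))
        ≡⟨ ∑-ne i (λ k → u i * (v k * (∑ w - w i) - v k * w k)) ⟩
      ∑ (λ k → u i * (v k * (∑ w - w i) - v k * w k)) - last
        ≡⟨ cong (_- last) (trans (∑-*ˡ (u i) (λ k → v k * (∑ w - w i) - v k * w k)) (cong (λ x → u i * x)
             (trans (∑-- (λ k → v k * (∑ w - w i)) (λ k → v k * w k)) (cong (_- VW)
               (trans (∑-cong (λ k → ℤ.*-comm (v k) (∑ w - w i))) (∑-*ˡ (∑ w - w i) v)))))) ⟩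
      u i * ((∑ w - w i) * ∑ v - VW) - last
        ≡⟨ lemma (u i) (∑ w) (w i) (∑ v) VW (v i) ⟩
      ∑ v * ∑ w * u i - ∑ v * (u i * w i) - VW * u i - ∑ w * (u i * v i) + + 2 * (u i * v i * w i) ∎
      where
      last = u i * (v i * (∑ w - w i) - v i * w i)
      lemma : ∀ u W w V VW v → u * ((W - w) * V - VW) - u * (v * (W - w) - v * w) ≡
        V * W * u - V * (u * w) - VW * u - W * (u * v) + + 2 * (u * v * w)
      lemma = solve-∀

  -- The bound for one fixed pair of vertices.

  pairBound : ℤ → ℤ
  pairBound N = + 2 * (N * (N - 1ℤ) * (N - + 2)) + + 10 * (N * N)

  *-nonneg : ∀ {x y} → 0ℤ ≤ x → 0ℤ ≤ y → 0ℤ ≤ x * y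
  *-nonneg {+ m} {+ n} _ _ = subst (0ℤ ≤_) (ℤ.pos-* m n) (+≤+ ℕ.z≤n)

  square-nonneg : ∀ x → 0ℤ ≤ x * x
  square-nonneg (+ n)    = *-nonneg {+ n} {+ n} (+≤+ ℕ.z≤n) (+≤+ ℕ.z≤n)
  square-nonneg -[1+ n ] = +≤+ ℕ.z≤n

  ∑-nonneg : {f : Fin n → ℤ} → (∀ i → 0ℤ ≤ f i) → 0ℤ ≤ ∑ f
  ∑-nonneg {n} {f} 0≤f = subst (_≤ ∑ f) (trans (∑-const n 0ℤ) (ℤ.*-zeroʳ (+ n))) (∑-mono-≤ {f = λ _ → 0ℤ} 0≤f)

  triple : (u v w : Fin n → ℤ) → ℤ
  triple u v w = ∑ λ i → ∑ λ k → ∑ λ m → Δ i k m * (u i * v k * w m)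

  ∑-linear₄ : ∀ x y z t (f g h k : Fin n → ℤ) →
    ∑ (λ i → x * f i + y * g i + z * h i + t * k i) ≡ x * ∑ f + y * ∑ g + z * ∑ h + t * ∑ k
  ∑-linear₄ x y z t f g h k =
    trans (∑-+ (λ i → x * f i + y * g i + z * h i) (λ i → t * k i)) (cong₂ _+_
      (trans (∑-+ (λ i → x * f i + y * g i) (λ i → z * h i)) (cong₂ _+_
        (trans (∑-+ (λ i → x * f i) (λ i → y * g i)) (cong₂ _+_
          (∑-*ˡ x f) (∑-*ˡ y g)))
        (∑-*ˡ z h)))
      (∑-*ˡ t k))

  module _ (w p q : Fin n → ℤ)
    (w²≡w : ∀ i → w i * w i ≡ w i) (p²≡w : ∀ i → p i * p i ≡ w i) (q²≡w : ∀ i → q i * q i ≡ w i)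
    (pw≡p : ∀ i → p i * w i ≡ p i) (qw≡q : ∀ i → q i * w i ≡ q i) where

    private
      N α β δ : ℤ
      N = ∑ w
      α = ∑ p
      β = ∑ q
      δ = ∑ (λ i → p i * q i)

      pq : Fin n → ℤ
      pq i = p i * q i

    -- 2 + 5 · paths with its second and fourth vertices fixed, in terms of
    -- the adjacency rows p and q of these two vertices.
    summand : Fin n → Fin n → Fin n → ℤ
    summand c d e = + 2 * (w c * w d * w e) + - + 5 * (p c * p d * w e)
      + - + 5 * (w c * q d * q e) + + 10 * (p c * pq d * q e)

    private
      triple-closed : ∀ (u v t : Fin n → ℤ) {U V T UV UT VT UVT} →
        ∑ u ≡ U → ∑ v ≡ V → ∑ t ≡ T →
        (∑ λ i → u i * v i) ≡ UV → (∑ λ i → u i * t i) ≡ UT → (∑ λ i → v i * t i) ≡ VT →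
        (∑ λ i → u i * v i * t i) ≡ UVT →
        triple u v t ≡ U * V * T - UV * T - UT * V - U * VT + + 2 * UVT
      triple-closed u v t refl refl refl refl refl refl refl = distinct-triples u v t

      www : triple w w w ≡ N * N * N - N * N - N * N - N * N + + 2 * N
      www = triple-closed w w w refl refl refl (∑-cong w²≡w) (∑-cong w²≡w) (∑-cong w²≡w)
        (∑-cong λ i → trans (cong (_* w i) (w²≡w i)) (w²≡w i))

      ppw : triple p p w ≡ α * α * N - N * N - α * α - α * α + + 2 * N
      ppw = triple-closed p p w refl refl refl (∑-cong p²≡w) (∑-cong pw≡p) (∑-cong pw≡p)
        (∑-cong λ i → trans (cong (_* w i) (p²≡w i)) (w²≡w i))

      wqq : triple w q q ≡ N * β * β - β * β - β * β - N * N + + 2 * N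
      wqq = triple-closed w q q refl refl refl (∑-cong wq≡q) (∑-cong wq≡q) (∑-cong q²≡w)
        (∑-cong λ i → trans (cong (_* q i) (wq≡q i)) (q²≡w i))
        where
        wq≡q : ∀ i → w i * q i ≡ q i
        wq≡q i = trans (ℤ.*-comm (w i) (q i)) (qw≡q i)

      -- The four-edge path: its middle vertex is adjacent to both fixed vertices and carries `pq`.
      -- By p² = q² = w, the product of `p` and `pq` reduces to `q`, that of `pq` and `q` to `p`,
      -- and that of all three to `w`.
      ppqq : triple p pq q ≡ α * δ * β - β * β - δ * δ - α * α + + 2 * N
      ppqq = triple-closed p pq q refl refl refl
        (∑-cong λ i → trans (lemma₁ (p i) (q i)) (trans (cong (q i *_) (p²≡w i)) (qw≡q i)))
        refl
        (∑-cong pqq≡p)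
        (∑-cong λ i → trans (lemma₂ (p i) (q i)) (trans (cong (p i *_) (pqq≡p i)) (p²≡w i)))
        where
        lemma₁ : ∀ x y → x * (x * y) ≡ y * (x * x)
        lemma₁ = solve-∀
        lemma₂ : ∀ x y → x * (x * y) * y ≡ x * (x * y * y)
        lemma₂ = solve-∀
        pqq≡p : ∀ i → pq i * q i ≡ p i
        pqq≡p i = trans (ℤ.*-assoc (p i) (q i) (q i)) (trans (cong (p i *_) (q²≡w i)) (pw≡p i))

      split : ∀ i k m → Δ i k m * summand i k m ≡
        + 2 * (Δ i k m * (w i * w k * w m)) + - + 5 * (Δ i k m * (p i * p k * w m))
          + - + 5 * (Δ i k m * (w i * q k * q m)) + + 10 * (Δ i k m * (p i * pq k * q m))
      split i k m = lemma (Δ i k m) (w i * w k * w m) (p i * p k * w m) (w i * q k * q m) (p i * pq k * q m)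
        where
        lemma : ∀ x f g h k → x * (+ 2 * f + - + 5 * g + - + 5 * h + + 10 * k) ≡
          + 2 * (x * f) + - + 5 * (x * g) + - + 5 * (x * h) + + 10 * (x * k)
        lemma = solve-∀

      ∑-summand : ∑ (λ i → ∑ λ k → ∑ λ m → Δ i k m * summand i k m) ≡
        + 2 * triple w w w + - + 5 * triple p p w + - + 5 * triple w q q + + 10 * triple p pq q
      ∑-summand =
        trans (∑-cong λ i → trans (∑-cong λ k → trans (∑-cong λ m → split i k m)
          (∑-linear₄ (+ 2) (- + 5) (- + 5) (+ 10) (λ m → Δ i k m * (w i * w k * w m)) (λ m → Δ i k m * (p i * p k * w m))
            (λ m → Δ i k m * (w i * q k * q m)) (λ m → Δ i k m * (p i * pq k * q m))))
          (∑-linear₄ (+ 2) (- + 5) (- + 5) (+ 10) (λ k → ∑ λ m → Δ i k m * (w i * w k * w m)) (λ k → ∑ λ m → Δ i k m * (p i * p k * w m))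
            (λ k → ∑ λ m → Δ i k m * (w i * q k * q m)) (λ k → ∑ λ m → Δ i k m * (p i * pq k * q m))))
          (∑-linear₄ (+ 2) (- + 5) (- + 5) (+ 10) (λ i → ∑ λ k → ∑ λ m → Δ i k m * (w i * w k * w m))
            (λ i → ∑ λ k → ∑ λ m → Δ i k m * (p i * p k * w m))
            (λ i → ∑ λ k → ∑ λ m → Δ i k m * (w i * q k * q m))
            (λ i → ∑ λ k → ∑ λ m → Δ i k m * (p i * pq k * q m)))

      -- After expansion the separate multiples of α² and β² cancel, leaving `pairBound N` + 10 α β
      -- δ - 5 N (α² + β²) - 10 δ². Thus `pairBound` is the value at α = β = δ = 0.
      value : ℤ
      value = + 2 * (N * N * N - N * N - N * N - N * N + + 2 * N)
        + - + 5 * (α * α * N - N * N - α * α - α * α + + 2 * N)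
        + - + 5 * (N * β * β - β * β - β * β - N * N + + 2 * N)
        + + 10 * (α * δ * β - β * β - δ * δ - α * α + + 2 * N)

      closed : ∑ (λ i → ∑ λ k → ∑ λ m → Δ i k m * summand i k m) ≡ value
      closed = trans ∑-summand (cong₂ _+_ (cong₂ _+_ (cong₂ _+_
        (cong (λ x → + 2 * x) www) (cong (λ x → - + 5 * x) ppw)) (cong (λ x → - + 5 * x) wqq)) (cong (λ x → + 10 * x) ppqq))

    private
      -- At `s` = 1 and `s` = -1, nonnegativity of the left side gives the two halves of |δ| ≤ N.
      signed-squares : ∀ s → s * s ≡ 1ℤ →
        ∑ (λ i → (p i - s * q i) * (p i - s * q i)) ≡ + 2 * N - + 2 * s * δ
      signed-squares s s²≡1 = begin
        ∑ (λ i → (p i - s * q i) * (p i - s * q i))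
          ≡⟨ ∑-cong (λ i → expand (p i) (q i) s) ⟩
        ∑ (λ i → p i * p i + s * s * (q i * q i) - + 2 * s * (p i * q i))
          ≡⟨ ∑-cong (λ i → cong (_- + 2 * s * (p i * q i)) (cong₂ _+_ (p²≡w i) (cong₂ _*_ s²≡1 (q²≡w i)))) ⟩
        ∑ (λ i → w i + 1ℤ * w i - + 2 * s * (p i * q i))
          ≡⟨ ∑-cong (λ i → cong (_- + 2 * s * (p i * q i)) (double (w i))) ⟩
        ∑ (λ i → + 2 * w i - + 2 * s * (p i * q i))
          ≡⟨ ∑-- (λ i → + 2 * w i) (λ i → + 2 * s * (p i * q i)) ⟩
        ∑ (λ i → + 2 * w i) - ∑ (λ i → + 2 * s * (p i * q i))
          ≡⟨ cong₂ _-_ (∑-*ˡ (+ 2) w) (∑-*ˡ (+ 2 * s) pq) ⟩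
        + 2 * N - + 2 * s * δ ∎
        where
        open ≡-Reasoning
        expand : ∀ x y s → (x - s * y) * (x - s * y) ≡ x * x + s * s * (y * y) - + 2 * s * (x * y)
        expand = solve-∀
        double : ∀ x → x + 1ℤ * x ≡ + 2 * x
        double = solve-∀

      2N-2sδ≥0 : ∀ s → s * s ≡ 1ℤ → 0ℤ ≤ + 2 * N - + 2 * s * δ
      2N-2sδ≥0 s s²≡1 = subst (0ℤ ≤_) (signed-squares s s²≡1)
        (∑-nonneg λ i → square-nonneg (p i - s * q i))

    -- |δ| ≤ N makes N (α² + β²) - 2 α β δ nonnegative.
    ∑-summand≤pairBound : ∑ (λ i → ∑ λ k → ∑ λ m → Δ i k m * summand i k m) ≤ pairBound N
    ∑-summand≤pairBound = subst (_≤ pairBound N) (sym closed) (ℤ.0≤i-j⇒j≤i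
      (ℤ.*-cancelˡ-≤-pos 0ℤ (pairBound N - value) (+ 4) (subst (0ℤ ≤_) (identity N α β δ)
        (*-nonneg {+ 5} (+≤+ ℕ.z≤n) (ℤ.+-mono-≤ (ℤ.+-mono-≤
          (*-nonneg (2N-2sδ≥0 1ℤ refl) (square-nonneg (α + β)))
          (*-nonneg (2N-2sδ≥0 -1ℤ refl) (square-nonneg (α - β))))
          (*-nonneg {+ 8} (+≤+ ℕ.z≤n) (square-nonneg δ)))))))
      where
      -- A certificate of nonnegativity: (2 N - 2 δ) (α + β)² + (2 N + 2 δ) (α - β)² equals 4 N (α²
      -- + β²) - 8 α β δ. The factor 4 clears the denominator in 4 α β = (α + β)² - (α - β)².
      identity : ∀ N α β δ →
        + 5 * ((+ 2 * N - + 2 * 1ℤ * δ) * ((α + β) * (α + β))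
          + (+ 2 * N - + 2 * -1ℤ * δ) * ((α - β) * (α - β)) + + 8 * (δ * δ)) ≡
        + 4 * (+ 2 * (N * (N - 1ℤ) * (N - + 2)) + + 10 * (N * N) -
         (+ 2 * (N * N * N - N * N - N * N - N * N + + 2 * N)
          + - + 5 * (α * α * N - N * N - α * α - α * α + + 2 * N)
          + - + 5 * (N * β * β - β * β - β * β - N * N + + 2 * N)
          + + 10 * (α * δ * β - β * β - δ * δ - α * α + + 2 * N)))
      identity = solve-∀

  -- Sums over five distinct vertices and their symmetries.

  F₅ : ℕ → Set
  F₅ n = (a b c d e : Fin n) → ℤ

  ∑⁵ : F₅ n → ℤ
  ∑⁵ f = ∑ λ a → ∑ λ b → ∑ λ c → ∑ λ d → ∑ λ e → f a b c d e

  ∑⁵-cong : {f g : F₅ n} → (∀ a b c d e → f a b c d e ≡ g a b c d e) → ∑⁵ f ≡ ∑⁵ g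
  ∑⁵-cong f≡g = ∑-cong λ a → ∑-cong λ b → ∑-cong λ c → ∑-cong λ d → ∑-cong λ e → f≡g a b c d e

  ∑⁵-+ : (f g : F₅ n) → ∑⁵ (λ a b c d e → f a b c d e + g a b c d e) ≡ ∑⁵ f + ∑⁵ g
  ∑⁵-+ f g =
    trans (∑-cong λ a → trans (∑-cong λ b → trans (∑-cong λ c → trans (∑-cong λ d →
      ∑-+ (f a b c d) (g a b c d)) (∑-+ _ _)) (∑-+ _ _)) (∑-+ _ _)) (∑-+ _ _)

  ∑⁵-*ˡ : ∀ x (f : F₅ n) → ∑⁵ (λ a b c d e → x * f a b c d e) ≡ x * ∑⁵ f
  ∑⁵-*ˡ x f =
    trans (∑-cong λ a → trans (∑-cong λ b → trans (∑-cong λ c → trans (∑-cong λ d →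
      ∑-*ˡ x (f a b c d)) (∑-*ˡ x _)) (∑-*ˡ x _)) (∑-*ˡ x _)) (∑-*ˡ x _)

  both : Fin n → Fin n → Fin n → ℤ
  both a b x = ne a x * ne b x

  -- The ten inequalities are grouped for fixed `a` and `b`: one mask for each remaining vertex,
  -- then the triple indicator `Δ`, matching the sums of `summand`.
  distinct : F₅ n
  distinct a b c d e = ne a b * (both a b c * both a b d * both a b e) * Δ c d e

  ∑≢ : F₅ n → ℤ
  ∑≢ f = ∑⁵ λ a b c d e → distinct a b c d e * f a b c d e

  ∑≢-cong : {f g : F₅ n} → (∀ a b c d e → f a b c d e ≡ g a b c d e) → ∑≢ f ≡ ∑≢ g
  ∑≢-cong f≡g = ∑⁵-cong λ a b c d e → cong (λ x → distinct a b c d e * x) (f≡g a b c d e)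

  ∑≢-+ : (f g : F₅ n) → ∑≢ (λ a b c d e → f a b c d e + g a b c d e) ≡ ∑≢ f + ∑≢ g
  ∑≢-+ f g = trans
    (∑⁵-cong λ a b c d e → ℤ.*-distribˡ-+ (distinct a b c d e) (f a b c d e) (g a b c d e))
    (∑⁵-+ (λ a b c d e → distinct a b c d e * f a b c d e) (λ a b c d e → distinct a b c d e * g a b c d e))

  ∑≢-*ˡ : ∀ x (f : F₅ n) → ∑≢ (λ a b c d e → x * f a b c d e) ≡ x * ∑≢ f
  ∑≢-*ˡ x f = trans (∑⁵-cong λ a b c d e → lemma (distinct a b c d e) x (f a b c d e))
    (∑⁵-*ˡ x λ a b c d e → distinct a b c d e * f a b c d e)
    where
    lemma : ∀ x y z → x * (y * z) ≡ y * (x * z)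
    lemma = solve-∀

  -- Exchanging two adjacent summations is compensated by the symmetry of `distinct`. This
  -- transposition and the next three generate all permutations of the five vertices.
  ∑≢-swap₁₂ : (f : F₅ n) → ∑≢ f ≡ ∑≢ λ a b c d e → f b a c d e
  ∑≢-swap₁₂ f = trans (∑-comm _) (∑⁵-cong λ a b c d e → cong (_* f b a c d e) (begin
    distinct b a c d e
      ≡⟨ cong (λ x → x * (both b a c * both b a d * both b a e) * Δ c d e) (ne-sym b a) ⟩
    ne a b * (both b a c * both b a d * both b a e) * Δ c d e
      ≡⟨ lemma (ne a b) (ne a c) (ne a d) (ne a e) (ne b c) (ne b d) (ne b e) (Δ c d e) ⟩
    distinct a b c d e ∎))
    where
    open ≡-Reasoning
    lemma : ∀ ab ac ad ae bc bd be Δ →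
      ab * ((bc * ac) * (bd * ad) * (be * ae)) * Δ ≡ ab * ((ac * bc) * (ad * bd) * (ae * be)) * Δ
    lemma = solve-∀

  ∑≢-swap₂₃ : (f : F₅ n) → ∑≢ f ≡ ∑≢ λ a b c d e → f a c b d e
  ∑≢-swap₂₃ f = trans (∑-cong λ a → ∑-comm _) (∑⁵-cong λ a b c d e → cong (_* f a c b d e) (begin
    distinct a c b d e
      ≡⟨ cong (λ x → ne a c * ((ne a b * x) * both a c d * both a c e) * Δ b d e) (ne-sym c b) ⟩
    ne a c * ((ne a b * ne b c) * both a c d * both a c e) * Δ b d e
      ≡⟨ lemma (ne a b) (ne a c) (ne a d) (ne a e) (ne b c) (ne b d) (ne b e) (ne c d) (ne c e) (ne d e) ⟩
    distinct a b c d e ∎))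
    where
    open ≡-Reasoning
    lemma : ∀ ab ac ad ae bc bd be cd ce de →
      ac * ((ab * bc) * (ad * cd) * (ae * ce)) * (bd * be * de) ≡
      ab * ((ac * bc) * (ad * bd) * (ae * be)) * (cd * ce * de)
    lemma = solve-∀

  ∑≢-swap₃₄ : (f : F₅ n) → ∑≢ f ≡ ∑≢ λ a b c d e → f a b d c e
  ∑≢-swap₃₄ f = trans (∑-cong λ a → ∑-cong λ b → ∑-comm _) (∑⁵-cong λ a b c d e → cong (_* f a b d c e) (begin
    distinct a b d c e
      ≡⟨ cong (λ x → ne a b * (both a b d * both a b c * both a b e) * (x * ne d e * ne c e)) (ne-sym d c) ⟩
    ne a b * (both a b d * both a b c * both a b e) * (ne c d * ne d e * ne c e)
      ≡⟨ lemma (ne a b) (both a b c) (both a b d) (both a b e) (ne c d) (ne c e) (ne d e) ⟩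
    distinct a b c d e ∎))
    where
    open ≡-Reasoning
    lemma : ∀ ab c d e cd ce de →
      ab * (d * c * e) * (cd * de * ce) ≡ ab * (c * d * e) * (cd * ce * de)
    lemma = solve-∀

  ∑≢-swap₄₅ : (f : F₅ n) → ∑≢ f ≡ ∑≢ λ a b c d e → f a b c e d
  ∑≢-swap₄₅ f = trans (∑-cong λ a → ∑-cong λ b → ∑-cong λ c → ∑-comm _) (∑⁵-cong λ a b c d e → cong (_* f a b c e d) (begin
    distinct a b c e d
      ≡⟨ cong (λ x → ne a b * (both a b c * both a b e * both a b d) * (ne c e * ne c d * x)) (ne-sym e d) ⟩
    ne a b * (both a b c * both a b e * both a b d) * (ne c e * ne c d * ne d e)
      ≡⟨ lemma (ne a b) (both a b c) (both a b d) (both a b e) (ne c d) (ne c e) (ne d e) ⟩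
    distinct a b c d e ∎))
    where
    open ≡-Reasoning
    lemma : ∀ ab c d e cd ce de →
      ab * (c * e * d) * (ce * cd * de) ≡ ab * (c * d * e) * (cd * ce * de)
    lemma = solve-∀

  ∑≢-rotate : (f : F₅ n) → ∑≢ f ≡ ∑≢ λ a b c d e → f b c d e a
  ∑≢-rotate f =
    trans (∑≢-swap₄₅ f) (trans (∑≢-swap₃₄ λ a b c d e → f a b c e d)
      (trans (∑≢-swap₂₃ λ a b c d e → f a b d e c) (∑≢-swap₁₂ λ a b c d e → f a c d e b)))

  -- The sequence b, a, e, d, c is the cycle run backwards. Started at `b`, the reversal swaps the
  -- first two places and reverses the last three, which takes four adjacent transpositions.
  ∑≢-reflect : (f : F₅ n) → ∑≢ f ≡ ∑≢ λ a b c d e → f b a e d c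
  ∑≢-reflect f =
    trans (∑≢-swap₁₂ f) (trans (∑≢-swap₃₄ λ a b c d e → f b a c d e)
      (trans (∑≢-swap₄₅ λ a b c d e → f b a d c e) (∑≢-swap₃₄ λ a b c d e → f b a e c d)))

  -- Brings the second and fourth arguments of f to the outermost sums.
  ∑≢-reorder : (f : F₅ n) → ∑≢ f ≡ ∑≢ λ j l i k m → f i j k l m
  ∑≢-reorder f =
    trans (∑≢-swap₃₄ f) (trans (∑≢-swap₁₂ λ a b c d e → f a b d c e)
      (∑≢-swap₂₃ λ a b c d e → f b a d c e))

  -- Counting vectors by sums of indicators.

  ∑ᵛ : ∀ k → (Vec (Fin n) k → ℤ) → ℤ
  ∑ᵛ zero    f = f []
  ∑ᵛ (suc k) f = ∑ λ x → ∑ᵛ k λ v → f (x ∷ v)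

  module _ {X : Set} {P : Pred X 0ℓ} (P? : Decidable P) where

    length-filter-∷ : ∀ x xs → + length (filter P? (x ∷ xs)) ≡ ⟦ P? x ⟧ + + length (filter P? xs)
    length-filter-∷ x xs with P? x
    ... | yes _ = refl
    ... | no _  = sym (ℤ.+-identityˡ _)

    length-filter-++ : ∀ xs ys → + length (filter P? (xs ++ ys)) ≡ + length (filter P? xs) + + length (filter P? ys)
    length-filter-++ xs ys = cong +_ (trans (cong length (List.filter-++ P? xs ys)) (List.length-++ (filter P? xs)))

  length-filter-map : ∀ {X Y : Set} {P : Pred Y 0ℓ} (P? : Decidable P) (f : X → Y) xs →
    length (filter P? (map f xs)) ≡ length (filter (P? ∘ f) xs)
  length-filter-map P? f []       = refl
  length-filter-map P? f (x ∷ xs) with P? (f x)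
  ... | yes _ = cong suc (length-filter-map P? f xs)
  ... | no _  = length-filter-map P? f xs

  length-filter-cartesian : ∀ {X Y Z : Set} {P : Pred Z 0ℓ} (P? : Decidable P) (f : X → Y → Z) {k} (xs : Fin k → X) ys →
    + length (filter P? (cartesianProductWith f (List.tabulate xs) ys)) ≡
    ∑ λ i → + length (filter (P? ∘ f (xs i)) ys)
  length-filter-cartesian P? f {zero}  xs ys = sym (∑-zero _)
  length-filter-cartesian P? f {suc k} xs ys = begin
    + length (filter P? (map (f (xs zero)) ys ++ rest))
      ≡⟨ length-filter-++ P? (map (f (xs zero)) ys) rest ⟩
    + length (filter P? (map (f (xs zero)) ys)) + + length (filter P? rest)
      ≡⟨ cong₂ _+_ (cong +_ (length-filter-map P? (f (xs zero)) ys)) (length-filter-cartesian P? f (xs ∘ suc) ys) ⟩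
    + length (filter (P? ∘ f (xs zero)) ys) + ∑ (λ i → + length (filter (P? ∘ f (xs (suc i))) ys))
      ≡⟨ ∑-suc _ ⟨
    ∑ (λ i → + length (filter (P? ∘ f (xs i)) ys)) ∎
    where
    open ≡-Reasoning
    rest = cartesianProductWith f (List.tabulate (xs ∘ suc)) ys

  length-filter-allVecs : ∀ k {P : Pred (Vec (Fin n) k) 0ℓ} (P? : Decidable P) →
    + length (filter P? (allVecs n k)) ≡ ∑ᵛ k λ v → ⟦ P? v ⟧
  length-filter-allVecs zero    P? = trans (length-filter-∷ P? [] []) (ℤ.+-identityʳ _)
  length-filter-allVecs {n} (suc k) P? = trans (length-filter-cartesian P? _∷_ (λ x → x) (allVecs n k))
    (∑-cong λ x → length-filter-allVecs k λ v → P? (x ∷ v))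

  -- The sign matrix of a tournament.

  ≡-⇒0 : ∀ x → x ≡ - x → x ≡ 0ℤ
  -- For nonzero `x` the two sides have different constructors, so no other clause arises.
  ≡-⇒0 (+ zero) _ = refl

  module _ (T : Tournament n) where
    open Tournament T

    -- As a difference of indicators it vanishes on the diagonal, and its antisymmetry is a ring
    -- identity.
    sgn : Fin n → Fin n → ℤ
    sgn u v = ⟦ u ⟶? v ⟧ - ⟦ v ⟶? u ⟧

    sgn-antisym : ∀ u v → sgn u v ≡ - sgn v u
    sgn-antisym u v = lemma ⟦ u ⟶? v ⟧ ⟦ v ⟶? u ⟧
      where
      lemma : ∀ x y → x - y ≡ - (y - x)
      lemma = solve-∀

    sgn-⟶ : ∀ {u v} → u ⟶ v → sgn u v ≡ 1ℤ
    sgn-⟶ {u} {v} u⟶v with u ⟶? v | v ⟶? u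
    ... | no ¬u⟶v | _       = contradiction u⟶v ¬u⟶v
    ... | yes _   | no _    = refl
    ... | yes _   | yes v⟶u with u Fin.≟ v
    ...   | yes refl = contradiction u⟶v (loopless u)
    ...   | no u≢v with oneOf u≢v
    ...     | inj₁ (_ , ¬v⟶u) = contradiction v⟶u ¬v⟶u
    ...     | inj₂ (¬u⟶v , _) = contradiction u⟶v ¬u⟶v

    sgn² : ∀ {u v} → u ≢ v → sgn u v * sgn u v ≡ 1ℤ
    sgn² {u} {v} u≢v with oneOf u≢v
    ... | inj₁ (u⟶v , _) = cong (λ x → x * x) (sgn-⟶ u⟶v)
    ... | inj₂ (_ , v⟶u) = cong (λ x → x * x) (trans (sgn-antisym u v) (cong -_ (sgn-⟶ v⟶u)))

    1+sgn-nonneg : ∀ u v → 0ℤ ≤ 1ℤ + sgn u v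
    1+sgn-nonneg u v with u ⟶? v | v ⟶? u
    ... | yes _ | yes _ = +≤+ ℕ.z≤n
    ... | yes _ | no _  = +≤+ ℕ.z≤n
    ... | no _  | yes _ = +≤+ ℕ.z≤n
    ... | no _  | no _  = +≤+ ℕ.z≤n

    -- Expansion of the product over the cyclic edges.

    Π⟨1+_⟩ : (Fin n → Fin n → ℤ) → F₅ n
    Π⟨1+ x ⟩ a b c d e = (1ℤ + x a b) * (1ℤ + x b c) * (1ℤ + x c d) * (1ℤ + x d e) * (1ℤ + x e a)

    -- The five rotations of `evenPart₁` have to yield every two-edge path twice. One copy is
    -- centred at the second vertex and one at the fourth, so that every edge in `paths` meets one
    -- of the two vertices to be fixed.
    paths disjointEdges evenPart₁ : F₅ n
    paths a b c d e = sgn a b * sgn b c + sgn c d * sgn d e + + 2 * (sgn a b * sgn b c * sgn c d * sgn d e)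
    disjointEdges a b c d e = sgn a b * sgn c d
    evenPart₁ a b c d e = paths a b c d e + + 2 * disjointEdges a b c d e

    ∑≢-disjointEdges : ∑≢ disjointEdges ≡ 0ℤ
    ∑≢-disjointEdges = ≡-⇒0 _ (begin
      ∑≢ disjointEdges                              ≡⟨ ∑≢-swap₁₂ disjointEdges ⟩
      ∑≢ (λ a b c d e → sgn b a * sgn c d)
        ≡⟨ ∑≢-cong (λ a b c d e → trans (cong (_* sgn c d) (sgn-antisym b a)) (lemma (sgn a b) (sgn c d))) ⟩
      ∑≢ (λ a b c d e → -1ℤ * disjointEdges a b c d e)  ≡⟨ ∑≢-*ˡ -1ℤ disjointEdges ⟩
      -1ℤ * ∑≢ disjointEdges                        ≡⟨ ℤ.-1*i≡-i _ ⟩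
      - ∑≢ disjointEdges                            ∎)
      where
      open ≡-Reasoning
      lemma : ∀ x y → - x * y ≡ -1ℤ * (x * y)
      lemma = solve-∀

    ∑≢-evenPart₁ : ∑≢ evenPart₁ ≡ ∑≢ paths
    ∑≢-evenPart₁ = begin
      ∑≢ evenPart₁                                   ≡⟨ ∑≢-+ paths (λ a b c d e → + 2 * disjointEdges a b c d e) ⟩
      ∑≢ paths + ∑≢ (λ a b c d e → + 2 * disjointEdges a b c d e) ≡⟨ cong (λ x → ∑≢ paths + x) (∑≢-*ˡ (+ 2) disjointEdges) ⟩
      ∑≢ paths + + 2 * ∑≢ disjointEdges              ≡⟨ cong (λ x → ∑≢ paths + + 2 * x) ∑≢-disjointEdges ⟩
      ∑≢ paths + 0ℤ                                  ≡⟨ ℤ.+-identityʳ _ ⟩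
      ∑≢ paths                                       ∎
      where open ≡-Reasoning

    ∑≢-reversal : ∑≢ Π⟨1+ sgn ⟩ ≡ ∑≢ Π⟨1+ (λ u v → - sgn u v) ⟩
    ∑≢-reversal = trans (∑≢-reflect Π⟨1+ sgn ⟩) (∑≢-cong λ a b c d e →
      trans (cong₂ _*_ (cong₂ _*_ (cong₂ _*_ (cong₂ _*_
        (cong (λ x → 1ℤ + x) (sgn-antisym b a)) (cong (λ x → 1ℤ + x) (sgn-antisym a e)))
        (cong (λ x → 1ℤ + x) (sgn-antisym e d))) (cong (λ x → 1ℤ + x) (sgn-antisym d c))) (cong (λ x → 1ℤ + x) (sgn-antisym c b)))
      (lemma (sgn a b) (sgn b c) (sgn c d) (sgn d e) (sgn e a)))
      where
      lemma : ∀ p q r s t →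
        (1ℤ + - p) * (1ℤ + - t) * (1ℤ + - s) * (1ℤ + - r) * (1ℤ + - q) ≡
        (1ℤ + - p) * (1ℤ + - q) * (1ℤ + - r) * (1ℤ + - s) * (1ℤ + - t)
      lemma = solve-∀

    -- Averaging over both orientations of a cycle kills the odd monomials;
    -- the even ones are the five rotations of evenPart₁.
    2∑≢-Π : + 2 * ∑≢ Π⟨1+ sgn ⟩ ≡ ∑≢ (λ a b c d e → + 2 + + 5 * paths a b c d e)
    2∑≢-Π = begin
      + 2 * ∑≢ Π⟨1+ sgn ⟩
        ≡⟨ double (∑≢ Π⟨1+ sgn ⟩) ⟩
      ∑≢ Π⟨1+ sgn ⟩ + ∑≢ Π⟨1+ sgn ⟩
        ≡⟨ cong (λ x → ∑≢ Π⟨1+ sgn ⟩ + x) ∑≢-reversal ⟩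
      ∑≢ Π⟨1+ sgn ⟩ + ∑≢ Π⟨1+ (λ u v → - sgn u v) ⟩
        ≡⟨ ∑≢-+ Π⟨1+ sgn ⟩ Π⟨1+ (λ u v → - sgn u v) ⟩ ⟨
      ∑≢ (λ a b c d e → Π⟨1+ sgn ⟩ a b c d e + Π⟨1+ (λ u v → - sgn u v) ⟩ a b c d e)
        ≡⟨ ∑≢-cong (λ a b c d e → even (sgn a b) (sgn b c) (sgn c d) (sgn d e) (sgn e a)) ⟩
      ∑≢ (λ a b c d e → + 2 + (g₀ a b c d e + (g₁ a b c d e + (g₂ a b c d e + (g₃ a b c d e + g₄ a b c d e)))))
        ≡⟨ trans (∑≢-+ two (λ a b c d e → g₀ a b c d e + (g₁ a b c d e + (g₂ a b c d e + (g₃ a b c d e + g₄ a b c d e)))))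
             (cong (λ x → ∑≢ two + x)
               (trans (∑≢-+ g₀ (λ a b c d e → g₁ a b c d e + (g₂ a b c d e + (g₃ a b c d e + g₄ a b c d e))))
                 (cong₂ _+_ (refl {x = ∑≢ g₀}) (trans (∑≢-+ g₁ (λ a b c d e → g₂ a b c d e + (g₃ a b c d e + g₄ a b c d e)))
                   (cong₂ _+_ g₁≡g₀ (trans (∑≢-+ g₂ (λ a b c d e → g₃ a b c d e + g₄ a b c d e))
                     (cong₂ _+_ g₂≡g₀ (trans (∑≢-+ g₃ g₄) (cong₂ _+_ g₃≡g₀ g₄≡g₀))))))))) ⟩
      ∑≢ two + (∑≢ g₀ + (∑≢ g₀ + (∑≢ g₀ + (∑≢ g₀ + ∑≢ g₀))))
        ≡⟨ cong (λ x → ∑≢ two + (x + (x + (x + (x + x))))) ∑≢-evenPart₁ ⟩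
      ∑≢ two + (∑≢ paths + (∑≢ paths + (∑≢ paths + (∑≢ paths + ∑≢ paths))))
        ≡⟨ five (∑≢ two) (∑≢ paths) ⟩
      ∑≢ two + + 5 * ∑≢ paths
        ≡⟨ cong (λ x → ∑≢ two + x) (∑≢-*ˡ (+ 5) paths) ⟨
      ∑≢ two + ∑≢ (λ a b c d e → + 5 * paths a b c d e)
        ≡⟨ ∑≢-+ two (λ a b c d e → + 5 * paths a b c d e) ⟨
      ∑≢ (λ a b c d e → + 2 + + 5 * paths a b c d e) ∎
      where
      open ≡-Reasoning
      two g₀ g₁ g₂ g₃ g₄ : F₅ n
      two a b c d e = + 2
      g₀ = evenPart₁
      g₁ a b c d e = g₀ b c d e a
      g₂ a b c d e = g₁ b c d e a
      g₃ a b c d e = g₂ b c d e a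
      g₄ a b c d e = g₃ b c d e a

      g₁≡g₀ : ∑≢ g₁ ≡ ∑≢ g₀
      g₁≡g₀ = sym (∑≢-rotate g₀)
      g₂≡g₀ : ∑≢ g₂ ≡ ∑≢ g₀
      g₂≡g₀ = trans (sym (∑≢-rotate g₁)) g₁≡g₀
      g₃≡g₀ : ∑≢ g₃ ≡ ∑≢ g₀
      g₃≡g₀ = trans (sym (∑≢-rotate g₂)) g₂≡g₀
      g₄≡g₀ : ∑≢ g₄ ≡ ∑≢ g₀
      g₄≡g₀ = trans (sym (∑≢-rotate g₃)) g₃≡g₀

      double : ∀ x → + 2 * x ≡ x + x
      double = solve-∀
      five : ∀ x y → x + (y + (y + (y + (y + y)))) ≡ x + + 5 * y
      five = solve-∀
      -- The odd elementary symmetric polynomials cancel and the even ones double. A product of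
      -- adjacent edges comes from two rotations; a product of two nonadjacent edges or of four
      -- edges comes from one, with coefficient 2.
      even : ∀ p q r s t →
        (1ℤ + p) * (1ℤ + q) * (1ℤ + r) * (1ℤ + s) * (1ℤ + t)
          + (1ℤ + - p) * (1ℤ + - q) * (1ℤ + - r) * (1ℤ + - s) * (1ℤ + - t) ≡
        + 2 + ((p * q + r * s + + 2 * (p * q * r * s) + + 2 * (p * r))
            + ((q * r + s * t + + 2 * (q * r * s * t) + + 2 * (q * s))
            + ((r * s + t * p + + 2 * (r * s * t * p) + + 2 * (r * t))
            + ((s * t + p * q + + 2 * (s * t * p * q) + + 2 * (s * p))
            +  (t * p + q * r + + 2 * (t * p * q * r) + + 2 * (t * q))))))
      even = solve-∀

    -- Masked adjacency rows and summation over pairs.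

    masked : Fin n → Fin n → Fin n → Fin n → ℤ
    masked a b u x = both a b x * sgn u x

    both-idem : ∀ (a b x : Fin n) → both a b x * both a b x ≡ both a b x
    both-idem a b x = trans (lemma (ne a x) (ne b x)) (cong₂ _*_ (ne-idem a x) (ne-idem b x))
      where
      lemma : ∀ x y → x * y * (x * y) ≡ x * x * (y * y)
      lemma = solve-∀

    ne-sgn² : ∀ u x → ne u x * (sgn u x * sgn u x) ≡ ne u x
    ne-sgn² u x = by-cases (u Fin.≟ x)
      where
      by-cases : Dec (u ≡ x) → ne u x * (sgn u x * sgn u x) ≡ ne u x
      by-cases (yes refl) = trans (cong (_* (sgn u u * sgn u u)) (ne-refl u))
        (trans (ℤ.*-zeroˡ (sgn u u * sgn u u)) (sym (ne-refl u)))
      by-cases (no u≢x)   = trans (cong₂ _*_ (ne-≢ u≢x) (sgn² u≢x)) (sym (ne-≢ u≢x))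

    module _ (a b : Fin n) where

      private
        w p q : Fin n → ℤ
        w = both a b
        p = masked a b a
        q = masked a b b

      p²≡w : ∀ x → p x * p x ≡ w x
      p²≡w x = trans (lemma (ne a x) (ne b x) (sgn a x)) (cong₂ _*_
        (trans (cong (λ y → y * (sgn a x * sgn a x)) (ne-idem a x)) (ne-sgn² a x)) (ne-idem b x))
        where
        lemma : ∀ x y s → x * y * s * (x * y * s) ≡ x * x * (s * s) * (y * y)
        lemma = solve-∀

      q²≡w : ∀ x → q x * q x ≡ w x
      q²≡w x = trans (lemma (ne a x) (ne b x) (sgn b x)) (cong₂ _*_ (ne-idem a x)
        (trans (cong (λ y → y * (sgn b x * sgn b x)) (ne-idem b x)) (ne-sgn² b x)))
        where
        lemma : ∀ x y s → x * y * s * (x * y * s) ≡ x * x * (y * y * (s * s))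
        lemma = solve-∀

      masked-both : ∀ u x → masked a b u x * w x ≡ masked a b u x
      masked-both u x = trans (lemma (w x) (sgn u x)) (cong (_* sgn u x) (both-idem a b x))
        where
        lemma : ∀ x s → x * s * x ≡ x * x * s
        lemma = solve-∀

      -- Along the path c, a, d, b, e the edges pointing into `a` and `b` are reversed to become row
      -- entries. A two-edge path picks up one sign, hence -5; the four-edge path picks up two,
      -- hence +10.
      distinct-paths : ∀ c d e → distinct a b c d e * (+ 2 + + 5 * paths c a d b e) ≡
        ne a b * (Δ c d e * summand w p q (both-idem a b) p²≡w q²≡w (masked-both a) (masked-both b) c d e)
      distinct-paths c d e = expand (ne a b) (w c) (w d) (w e) (Δ c d e)
        (sgn-antisym c a) (sgn a d) (sgn-antisym d b) (sgn b e) (both-idem a b d)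
        where
        expand : ∀ ab c d e Δ {ca ac} → ca ≡ - ac → ∀ ad {db bd} → db ≡ - bd → ∀ be → d * d ≡ d →
          ab * (c * d * e) * Δ * (+ 2 + + 5 * (ca * ad + db * be + + 2 * (ca * ad * db * be))) ≡
          ab * (Δ * (+ 2 * (c * d * e) + - + 5 * (c * ac * (d * ad) * e)
            + - + 5 * (c * (d * bd) * (e * be)) + + 10 * (c * ac * (d * ad * (d * bd)) * (e * be))))
        expand ab c d e Δ {ac = ac} refl ad {bd = bd} refl be d²≡d =
          trans (lemma ab c d e Δ ac ad bd be) (cong factored
            -- The middle vertex carries entries of both rows, each with its own mask, while
            -- `distinct` supplies the mask once; idempotence duplicates it.
            (trans (cong (λ x → x * (ad * bd)) (sym d²≡d)) (interchange d ad bd)))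
          where
          factored : ℤ → ℤ
          factored x = ab * (Δ * (+ 2 * (c * d * e) + - + 5 * (c * ac * (d * ad) * e)
            + - + 5 * (c * (d * bd) * (e * be)) + + 10 * (c * ac * x * (e * be))))
          interchange : ∀ w x y → w * w * (x * y) ≡ w * x * (w * y)
          interchange = solve-∀
          lemma : ∀ ab c d e Δ ac ad bd be →
            ab * (c * d * e) * Δ * (+ 2 + + 5 * (- ac * ad + - bd * be + + 2 * (- ac * ad * - bd * be))) ≡
            ab * (Δ * (+ 2 * (c * d * e) + - + 5 * (c * ac * (d * ad) * e)
              + - + 5 * (c * (d * bd) * (e * be)) + + 10 * (c * ac * (d * (ad * bd)) * (e * be))))
          lemma = solve-∀

      both-sum : a ≢ b → ∑ w ≡ + n - + 2
      both-sum a≢b = begin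
        -- The inserted factor `ne a b`, equal to 1 here, completes the pattern of `∑-ne²`.
        ∑ w                                                     ≡⟨ ∑-cong (λ x → unit (ne a b) (ne a x) (ne b x) (ne-≢ a≢b)) ⟩
        ∑ (λ x → ne a b * ne a x * ne b x * 1ℤ)                 ≡⟨ ∑-ne² a b (λ _ → 1ℤ) ⟩
        ne a b * (∑ {n} (λ _ → 1ℤ) - 1ℤ - 1ℤ)                   ≡⟨ cong₂ (λ x y → x * (y - 1ℤ - 1ℤ)) (ne-≢ a≢b) (∑-const n 1ℤ) ⟩
        1ℤ * (+ n * 1ℤ - 1ℤ - 1ℤ)                               ≡⟨ simplify (+ n) ⟩
        + n - + 2                                               ∎
        where
        open ≡-Reasoning
        unit : ∀ z x y → z ≡ 1ℤ → x * y ≡ z * x * y * 1ℤ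
        unit z x y refl = lemma x y
          where
          lemma : ∀ x y → x * y ≡ 1ℤ * x * y * 1ℤ
          lemma = solve-∀
        simplify : ∀ m → 1ℤ * (m * 1ℤ - 1ℤ - 1ℤ) ≡ m - + 2
        simplify = solve-∀

      ∑-distinct-paths≤ : ∑ (λ c → ∑ λ d → ∑ λ e → distinct a b c d e * (+ 2 + + 5 * paths c a d b e)) ≤
        ne a b * pairBound (+ n - + 2)
      ∑-distinct-paths≤ = subst (_≤ ne a b * pairBound (+ n - + 2)) (sym pulled) (by-cases (a Fin.≟ b))
        where
        total = ∑ λ c → ∑ λ d → ∑ λ e →
          Δ c d e * summand w p q (both-idem a b) p²≡w q²≡w (masked-both a) (masked-both b) c d e

        pulled : ∑ (λ c → ∑ λ d → ∑ λ e → distinct a b c d e * (+ 2 + + 5 * paths c a d b e)) ≡ ne a b * total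
        pulled = trans (∑-cong λ c → trans (∑-cong λ d → trans (∑-cong λ e → distinct-paths c d e)
          (∑-*ˡ (ne a b) _)) (∑-*ˡ (ne a b) _)) (∑-*ˡ (ne a b) _)

        total≤ : total ≤ pairBound (∑ w)
        total≤ = ∑-summand≤pairBound w p q (both-idem a b) p²≡w q²≡w (masked-both a) (masked-both b)

        by-cases : Dec (a ≡ b) → ne a b * total ≤ ne a b * pairBound (+ n - + 2)
        -- For equal vertices the mask leaves n - 1 vertices instead of n - 2, so this case is
        -- settled by the factor `ne a b`, which makes both sides zero.
        by-cases (yes a≡b) = ℤ.≤-reflexive (trans (vanish total) (sym (vanish (pairBound (+ n - + 2)))))
          where
          vanish : ∀ x → ne a b * x ≡ 0ℤ
          vanish x = trans (cong (_* x) (trans (cong (ne a) (sym a≡b)) (ne-refl a))) (ℤ.*-zeroˡ x)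
        by-cases (no a≢b) = subst₂ _≤_ (sym (unit total)) (sym (unit (pairBound (+ n - + 2))))
          (subst (λ N → total ≤ pairBound N) (both-sum a≢b) total≤)
          where
          unit : ∀ x → ne a b * x ≡ x
          unit x = trans (cong (_* x) (ne-≢ a≢b)) (ℤ.*-identityˡ x)

    2∑≢-Π≤ : + 2 * ∑≢ Π⟨1+ sgn ⟩ ≤ + n * (+ n - 1ℤ) * pairBound (+ n - + 2)
    2∑≢-Π≤ = begin
      + 2 * ∑≢ Π⟨1+ sgn ⟩                                         ≡⟨ 2∑≢-Π ⟩
      ∑≢ (λ a b c d e → + 2 + + 5 * paths a b c d e)              ≡⟨ ∑≢-reorder (λ a b c d e → + 2 + + 5 * paths a b c d e) ⟩
      ∑≢ (λ a b c d e → + 2 + + 5 * paths c a d b e)              ≤⟨ ∑-mono-≤ (λ a → ∑-mono-≤ λ b → ∑-distinct-paths≤ a b) ⟩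
      ∑ (λ a → ∑ {n} λ b → ne a b * K)                            ≡⟨ ∑-cong (λ a → ∑-ne a (λ _ → K)) ⟩
      ∑ {n} (λ a → ∑ {n} (λ _ → K) - K)                           ≡⟨ ∑-const n (∑ {n} (λ _ → K) - K) ⟩
      + n * (∑ {n} (λ _ → K) - K)                                 ≡⟨ cong (λ x → + n * (x - K)) (∑-const n K) ⟩
      + n * (+ n * K - K)                                         ≡⟨ lemma (+ n) K ⟩
      + n * (+ n - 1ℤ) * K                                        ∎
      where
      open ℤ.≤-Reasoning
      K : ℤ
      K = pairBound (+ n - + 2)
      lemma : ∀ m k → m * (m * k - k) ≡ m * (m - 1ℤ) * k
      lemma = solve-∀

    -- Comparison of the cycle count with the product sum.

    distinct-nonneg : ∀ (a b c d e : Fin n) → 0ℤ ≤ distinct a b c d e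
    distinct-nonneg a b c d e = product-nonneg (ne-nonneg a b) (both-nonneg c) (both-nonneg d) (both-nonneg e)
      (ne-nonneg c d) (ne-nonneg c e) (ne-nonneg d e)
      where
      both-nonneg : ∀ x → 0ℤ ≤ both a b x
      both-nonneg x = *-nonneg {ne a x} {ne b x} (ne-nonneg a x) (ne-nonneg b x)

      product-nonneg : ∀ {x y₁ y₂ y₃ z₁ z₂ z₃} → 0ℤ ≤ x → 0ℤ ≤ y₁ → 0ℤ ≤ y₂ → 0ℤ ≤ y₃ → 0ℤ ≤ z₁ → 0ℤ ≤ z₂ → 0ℤ ≤ z₃ →
        0ℤ ≤ x * (y₁ * y₂ * y₃) * (z₁ * z₂ * z₃)
      product-nonneg {x} {y₁} {y₂} {y₃} {z₁} {z₂} {z₃} x≥0 y₁≥0 y₂≥0 y₃≥0 z₁≥0 z₂≥0 z₃≥0 =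
        *-nonneg {x * (y₁ * y₂ * y₃)} {z₁ * z₂ * z₃}
          (*-nonneg {x} {y₁ * y₂ * y₃} x≥0 (*-nonneg {y₁ * y₂} {y₃} (*-nonneg y₁≥0 y₂≥0) y₃≥0))
          (*-nonneg {z₁ * z₂} {z₃} (*-nonneg z₁≥0 z₂≥0) z₃≥0)

    Π-nonneg : ∀ a b c d e → 0ℤ ≤ Π⟨1+ sgn ⟩ a b c d e
    Π-nonneg a b c d e = product-nonneg (1+sgn-nonneg a b) (1+sgn-nonneg b c) (1+sgn-nonneg c d) (1+sgn-nonneg d e) (1+sgn-nonneg e a)
      where
      product-nonneg : ∀ {p q r s t} → 0ℤ ≤ p → 0ℤ ≤ q → 0ℤ ≤ r → 0ℤ ≤ s → 0ℤ ≤ t → 0ℤ ≤ p * q * r * s * t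
      product-nonneg {p} {q} {r} {s} {t} p≥0 q≥0 r≥0 s≥0 t≥0 =
        *-nonneg {p * q * r * s} (*-nonneg {p * q * r} (*-nonneg {p * q} (*-nonneg p≥0 q≥0) r≥0) s≥0) t≥0

    -- Each of the five edges of a cycle contributes a factor 2; for other tuples nonnegativity
    -- suffices. The decision is a separate argument, so that matching on it evaluates `⟦ cyc? ⟧`.
    32⟦cycle⟧≤ : ∀ a b c d e (cyc? : Dec (IsCycle T (a ∷ b ∷ c ∷ d ∷ e ∷ []))) →
      + 32 * ⟦ cyc? ⟧ ≤ distinct a b c d e * Π⟨1+ sgn ⟩ a b c d e
    32⟦cycle⟧≤ a b c d e (no _) =
      *-nonneg {distinct a b c d e} {Π⟨1+ sgn ⟩ a b c d e} (distinct-nonneg a b c d e) (Π-nonneg a b c d e)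
    32⟦cycle⟧≤ a b c d e (yes (inj , edge)) = ℤ.≤-reflexive (sym (cong₂ _*_ distinct≡1 Π≡32))
      where
      v = a ∷ b ∷ c ∷ d ∷ e ∷ []

      ne≡1 : ∀ i j → i ≢ j → ne (lookup v i) (lookup v j) ≡ 1ℤ
      ne≡1 i j i≢j = ne-≢ (i≢j ∘ inj i j)

      distinct≡1 : distinct a b c d e ≡ 1ℤ
      distinct≡1 = cong₂ _*_
        (cong₂ _*_ (ne≡1 0F 1F λ()) (cong₂ _*_ (cong₂ _*_
          (cong₂ _*_ (ne≡1 0F 2F λ()) (ne≡1 1F 2F λ()))
          (cong₂ _*_ (ne≡1 0F 3F λ()) (ne≡1 1F 3F λ())))
          (cong₂ _*_ (ne≡1 0F 4F λ()) (ne≡1 1F 4F λ()))))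
        (cong₂ _*_ (cong₂ _*_ (ne≡1 2F 3F λ()) (ne≡1 2F 4F λ())) (ne≡1 3F 4F λ()))

      1+sgn≡2 : ∀ i → 1ℤ + sgn (lookup v i) (lookup v (ℕ.suc (toℕ i) mod 5)) ≡ + 2
      1+sgn≡2 i = cong (λ x → 1ℤ + x) (sgn-⟶ (edge i))

      Π≡32 : Π⟨1+ sgn ⟩ a b c d e ≡ + 32
      Π≡32 = cong₂ _*_ (cong₂ _*_ (cong₂ _*_ (cong₂ _*_
        (1+sgn≡2 0F) (1+sgn≡2 1F)) (1+sgn≡2 2F)) (1+sgn≡2 3F)) (1+sgn≡2 4F)

    32count≤ : + 32 * + length (filter (isCycle? T) (allVecs n 5)) ≤ ∑≢ Π⟨1+ sgn ⟩
    32count≤ = begin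
      + 32 * + length (filter (isCycle? T) (allVecs n 5))
        ≡⟨ cong (λ x → + 32 * x) (length-filter-allVecs 5 (isCycle? T)) ⟩
      + 32 * ∑ᵛ 5 (λ v → ⟦ isCycle? T v ⟧)
        -- `∑ᵛ 5` computes to the five nested sums of `∑⁵`.
        ≡⟨ ∑⁵-*ˡ (+ 32) (λ a b c d e → ⟦ isCycle? T (a ∷ b ∷ c ∷ d ∷ e ∷ []) ⟧) ⟨
      ∑⁵ (λ a b c d e → + 32 * ⟦ isCycle? T (a ∷ b ∷ c ∷ d ∷ e ∷ []) ⟧)
        ≤⟨ ∑-mono-≤ (λ a → ∑-mono-≤ λ b → ∑-mono-≤ λ c → ∑-mono-≤ λ d → ∑-mono-≤ λ e →
             32⟦cycle⟧≤ a b c d e (isCycle? T (a ∷ b ∷ c ∷ d ∷ e ∷ []))) ⟩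
      ∑≢ Π⟨1+ sgn ⟩ ∎
      where open ℤ.≤-Reasoning

  -- Falling factorials and binomial coefficients.

  falling : ℤ → ℕ → ℤ
  falling m zero    = 1ℤ
  falling m (suc k) = falling m k * (m - + k)

  falling-0 : ∀ k → falling 0ℤ (suc k) ≡ 0ℤ
  falling-0 zero    = refl
  falling-0 (suc k) = trans (cong (_* (0ℤ - + suc k)) (falling-0 k)) (ℤ.*-zeroˡ (0ℤ - + suc k))

  falling-suc : ∀ m k → falling (1ℤ + m) (suc k) ≡ (1ℤ + m) * falling m k
  falling-suc m zero    = lemma m
    where
    lemma : ∀ m → 1ℤ * (1ℤ + m - 0ℤ) ≡ (1ℤ + m) * 1ℤ
    lemma = solve-∀
  falling-suc m (suc k) = trans (cong (_* (1ℤ + m - + suc k)) (falling-suc m k)) (lemma m (falling m k) (+ k))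
    where
    lemma : ∀ m f k → (1ℤ + m) * f * (1ℤ + m - (1ℤ + k)) ≡ (1ℤ + m) * (f * (m - k))
    lemma = solve-∀

  -- Pascal's rule is matched with the recurrences of the falling factorial. If `k` exceeds `n`, a
  -- factor of `falling` vanishes together with the binomial coefficient.
  !*C≡falling : ∀ n k → + (k !) * + (n C k) ≡ falling (+ n) k
  !*C≡falling zero    zero    = refl
  !*C≡falling (suc n) zero    = refl
  !*C≡falling zero    (suc k) = trans (ℤ.*-zeroʳ (+ (suc k !))) (sym (falling-0 k))
  !*C≡falling (suc n) (suc k) = begin
    + (suc k !) * + (suc n C suc k)
      ≡⟨ cong (λ x → + (suc k !) * + x) (nCk+nC[k+1]≡[n+1]C[k+1] n k) ⟨
    + (suc k !) * (+ (n C k) + + (n C suc k))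
      ≡⟨ ℤ.*-distribˡ-+ (+ (suc k !)) (+ (n C k)) (+ (n C suc k)) ⟩
    + (suc k !) * + (n C k) + + (suc k !) * + (n C suc k)
      ≡⟨ cong₂ _+_ (trans (cong (_* + (n C k)) (ℤ.pos-* (suc k) (k !))) (ℤ.*-assoc (+ suc k) (+ (k !)) (+ (n C k))))
           (!*C≡falling n (suc k)) ⟩
    + suc k * (+ (k !) * + (n C k)) + falling (+ n) (suc k)
      ≡⟨ cong (λ x → + suc k * x + falling (+ n) (suc k)) (!*C≡falling n k) ⟩
    + suc k * falling (+ n) k + falling (+ n) k * (+ n - + k)
      ≡⟨ lemma (+ k) (+ n) (falling (+ n) k) ⟩
    (1ℤ + + n) * falling (+ n) k
      ≡⟨ falling-suc (+ n) k ⟨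
    falling (+ suc n) (suc k) ∎
    where
    open ≡-Reasoning
    lemma : ∀ k m f → (1ℤ + k) * f + f * (m - k) ≡ (1ℤ + m) * f
    lemma = solve-∀

  -- Clearing denominators and collecting the constants.

  rational-bound : ∀ c x y z → + 64 * c ≤ + 48 * x + + 4 * (y * (z * z)) →
    c ℚ./ 1 ℚ.≤ (+ 3 ℚ./ 4) ℚ.* (x ℚ./ 1) ℚ.+ (+ 1 ℚ./ 4) ℚ.* (y ℚ./ 1) ℚ.* (z ℚ./ 2) ²
  rational-bound c x y z h = ℚ.toℚᵘ-cancel-≤ (begin
    ℚ.toℚᵘ (c ℚ./ 1)                            ≃⟨ ℚ.toℚᵘ-fromℚᵘ (c ℚᵘ./ 1) ⟩
    -- The unreduced denominators of the two terms are 4 and 4 · 2 · 2 = 16, so the common one is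
    -- 64, with numerator coefficients 3 · 16 = 48 and 4.
    c ℚᵘ./ 1                                    ≤⟨ ℚᵘ.*≤* (subst₂ _≤_ (ℤ.*-comm (+ 64) c) (lemma x y z) h) ⟩
    ¾ ℚᵘ.* X ℚᵘ.+ ¼ ℚᵘ.* Y ℚᵘ.* (Z ℚᵘ.* Z)      ≃⟨ ℚᵘ.≃-sym homo ⟩
    ℚ.toℚᵘ ((+ 3 ℚ./ 4) ℚ.* (x ℚ./ 1) ℚ.+ (+ 1 ℚ./ 4) ℚ.* (y ℚ./ 1) ℚ.* (z ℚ./ 2) ²) ∎)
    where
    open ℚᵘ.≤-Reasoning
    ¾ = + 3 ℚᵘ./ 4
    ¼ = + 1 ℚᵘ./ 4
    X = x ℚᵘ./ 1
    Y = y ℚᵘ./ 1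
    Z = z ℚᵘ./ 2

    lemma : ∀ x y z → + 48 * x + + 4 * (y * (z * z)) ≡ (+ 3 * x * + 16 + + 1 * y * (z * z) * + 4) * + 1
    lemma = solve-∀

    ≃-* : ∀ p q {p′ q′} → ℚ.toℚᵘ p ℚᵘ.≃ p′ → ℚ.toℚᵘ q ℚᵘ.≃ q′ → ℚ.toℚᵘ (p ℚ.* q) ℚᵘ.≃ p′ ℚᵘ.* q′
    ≃-* p q p≃ q≃ = ℚᵘ.≃-trans (ℚ.toℚᵘ-homo-* p q) (ℚᵘ.*-cong p≃ q≃)

    homo : ℚ.toℚᵘ ((+ 3 ℚ./ 4) ℚ.* (x ℚ./ 1) ℚ.+ (+ 1 ℚ./ 4) ℚ.* (y ℚ./ 1) ℚ.* (z ℚ./ 2) ²) ℚᵘ.≃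
           ¾ ℚᵘ.* X ℚᵘ.+ ¼ ℚᵘ.* Y ℚᵘ.* (Z ℚᵘ.* Z)
    homo = ℚᵘ.≃-trans (ℚ.toℚᵘ-homo-+ ((+ 3 ℚ./ 4) ℚ.* (x ℚ./ 1)) ((+ 1 ℚ./ 4) ℚ.* (y ℚ./ 1) ℚ.* (z ℚ./ 2) ²))
      (ℚᵘ.+-cong
        (≃-* (+ 3 ℚ./ 4) (x ℚ./ 1) (ℚ.toℚᵘ-fromℚᵘ ¾) (ℚ.toℚᵘ-fromℚᵘ X))
        (≃-* ((+ 1 ℚ./ 4) ℚ.* (y ℚ./ 1)) ((z ℚ./ 2) ²)
          (≃-* (+ 1 ℚ./ 4) (y ℚ./ 1) (ℚ.toℚᵘ-fromℚᵘ ¼) (ℚ.toℚᵘ-fromℚᵘ Y))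
          (≃-* (z ℚ./ 2) (z ℚ./ 2) (ℚ.toℚᵘ-fromℚᵘ Z) (ℚ.toℚᵘ-fromℚᵘ Z))))

  -- With N = n - 2, the cubic term completes n (n - 1) to 5! times `n C 5`, and n (n - 1) is twice
  -- `n C 2`. Since 2 · 120 = 5 · 48 and 10 · 2 = 5 · 4, a factor 5 splits off, which cancels
  -- against the five rotations of a cycle.
  bound-in-binomials : ∀ n → let N = + n - + 2 in
    + n * (+ n - 1ℤ) * pairBound N ≡
    + 5 * (+ 48 * + (n C 5) + + 4 * (+ (n C 2) * (N * N)))
  bound-in-binomials n = begin
    m * (m - 1ℤ) * pairBound N
      ≡⟨ lemma m ⟩
    + 2 * falling m 5 + + 10 * (falling m 2 * (N * N))
      ≡⟨ cong₂ (λ x y → + 2 * x + + 10 * (y * (N * N))) (!*C≡falling n 5) (!*C≡falling n 2) ⟨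
    + 2 * (+ 120 * + (n C 5)) + + 10 * (+ 2 * + (n C 2) * (N * N))
      ≡⟨ lemma′ (+ (n C 5)) (+ (n C 2)) N ⟩
    + 5 * (+ 48 * + (n C 5) + + 4 * (+ (n C 2) * (N * N))) ∎
    where
    open ≡-Reasoning
    m N : ℤ
    m = + n
    N = m - + 2
    lemma : ∀ m → m * (m - 1ℤ) * (+ 2 * ((m - + 2) * (m - + 2 - 1ℤ) * (m - + 2 - + 2)) + + 10 * ((m - + 2) * (m - + 2))) ≡
      + 2 * (1ℤ * (m - 0ℤ) * (m - 1ℤ) * (m - + 2) * (m - + 3) * (m - + 4))
        + + 10 * (1ℤ * (m - 0ℤ) * (m - 1ℤ) * ((m - + 2) * (m - + 2)))
    lemma = solve-∀
    lemma′ : ∀ x y z → + 2 * (+ 120 * x) + + 10 * (+ 2 * y * (z * z)) ≡ + 5 * (+ 48 * x + + 4 * (y * (z * z)))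
    lemma′ = solve-∀

  chain : ∀ c count Π B → c * + 5 ≤ count → + 32 * count ≤ Π → + 2 * Π ≤ + 5 * B → + 64 * c ≤ B
  chain c count Π B 5c≤count 32count≤Π 2Π≤5B = ℤ.*-cancelˡ-≤-pos (+ 64 * c) B (+ 5) (begin
    + 5 * (+ 64 * c)           ≡⟨ lemma c ⟩
    + 2 * (+ 32 * (c * + 5)) ≤⟨ ℤ.*-monoˡ-≤-nonNeg (+ 2) (ℤ.*-monoˡ-≤-nonNeg (+ 32) 5c≤count) ⟩
    + 2 * (+ 32 * count)       ≤⟨ ℤ.*-monoˡ-≤-nonNeg (+ 2) 32count≤Π ⟩
    + 2 * Π                      ≤⟨ 2Π≤5B ⟩
    + 5 * B                      ∎)
    where
    open ℤ.≤-Reasoning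
    lemma : ∀ x → + 5 * (+ 64 * x) ≡ + 2 * (+ 32 * (x * + 5))
    lemma = solve-∀

  64c≤ : ∀ {n} (T : Tournament n) → let N = + n - + 2 in
    + 64 * + c T 5 ≤ + 48 * + (n C 5) + + 4 * (+ (n C 2) * (N * N))
  64c≤ {n} T = chain (+ c T 5) count (∑≢ (Π⟨1+_⟩ T (sgn T))) (+ 48 * + (n C 5) + + 4 * (+ (n C 2) * (N * N)))
    (subst (_≤ count) (ℤ.pos-* (c T 5) 5) (+≤+ (c*k≤cyclic T)))
    (32count≤ T)
    (ℤ.≤-trans (2∑≢-Π≤ T) (ℤ.≤-reflexive (bound-in-binomials n)))
    where
    N = + n - + 2
    count = + length (filter (isCycle? T) (allVecs n 5))

open SignSums using (rational-bound; 64c≤)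
open import Data.Rational.Base using (_/_; _+_; _*_; _≤_)

corollary2p2 : (n : ℕ) (T : Tournament n) →
    + (c T 5) / 1 ≤ (+ 3 / 4) * (+ (n C 5) / 1) + (+ 1 / 4) * (+ (n C 2) / 1) * ((+ n ℤ.- + 2) / 2) ²
corollary2p2 n T = rational-bound (+ c T 5) (+ (n C 5)) (+ (n C 2)) (+ n ℤ.- + 2) (64c≤ T)
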